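{- Suppose that $\mathcal{X}=((X_n)_{n\in\omega},(\phi_n)_{n\in\omega})$ is a vast inverse system of permutative LD-systems. (1) $\mathrm{EE}(\mathcal{X})$ is a dense $G_\delta$ subset of $\varprojlim_{n\in\omega}X_n$, and $\mathrm{EE}(\mathcal{X})^+$ is a dense open subset of $\mathrm{EE}(\mathcal{X})$. (2) $\mathrm{EE}(\mathcal{X})$ and $\mathrm{EE}(\mathcal{X})^+$ are closed under $*$. If each $X_n$ is reduced, then $\mathrm{EE}(\mathcal{X})$ and $\mathrm{EE}(\mathcal{X})^+$ are closed under $\circ$. (3) $(\mathrm{EE}(\mathcal{X})^+,*)$ is an acyclic LD-system. (4) Every element of $\mathrm{EE}(\mathcal{X})^+$ freely generates a sub-LD-system of $(\mathrm{EE}(\mathcal{X})^+,*)$. Furthermore, if $\mathcal{X}$ is a vast system of permutative LD-monoids, then every element of $\mathrm{EE}(\mathcal{X})\setminus\{1\}$ freely generates a sub-LD-monoid of $(\mathrm{EE}(\mathcal{X}),*,\circ,1)$.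
   Context: LD-system: a set with a binary operation satisfying $x*(y*z)=(x*y)*(x*z)$. $\mathrm{Li}(X)$ is the set of $x\in X$ with $x*y=y$ for all $y$. $X$ is permutative if $\mathrm{Li}(X)$ is a left-ideal ($y\in\mathrm{Li}(X)$ implies $x*y\in\mathrm{Li}(X)$ for all $x$) and for all $x,y$ there is $k\ge1$ with $t_k(x,y)\in\mathrm{Li}(X)$, where $t_1(x,y)=y$, $t_2(x,y)=x$, $t_{k+2}(x,y)=t_{k+1}(x,y)*t_k(x,y)$. $X$ is reduced if $\mathrm{Li}(X)=\{1\}$ is a singleton; then there is a unique operation $\circ$ with $x\circ y=(x*y)\circ x$, $x\circ1=x$, and $(X,*,\circ,1)$ is an LD-monoid, called a permutative LD-monoid. LD-monoid: $(X,\circ,1)$ is a monoid and $(x\circ y)*z=x*(y*z)$, $x*(y\circ z)=(x*y)\circ(x*z)$, $x\circ y=(x*y)\circ x$, $1*x=x$, $x*1=1$. Critical points in a permutative $X$: $\mathrm{crit}(x)\le\mathrm{crit}(y)$ means $x^k*y\in\mathrm{Li}(X)$ for some $k\ge0$, where $x^0*y=y$, $x^{k+1}*y=x*(x^k*y)$; $\mathrm{crit}(x)$ is the class of $x$ under the induced equivalence; $\mathrm{crit}[X]$ is the set of these, linearly ordered with a greatest element; $x^\sharp(\mathrm{crit}(r))=\mathrm{crit}(x*r)$. For $\alpha\in\mathrm{crit}[X]$, $x\equiv^\alpha y$ iff $r*x=r*y$ for any (equivalently some) $r$ with $\mathrm{crit}(r)=\alpha$ and $r*r\in\mathrm{Li}(X)$;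 it is a congruence. Vast: an inverse system of permutative LD-systems with transition homomorphisms $\phi_n:X_{n+1}\to X_n$ (and composites $\phi_{m,n}:X_m\to X_n$) is vast if (i) for each $n$ there is $\alpha_n\in\mathrm{crit}[X_{n+1}]$ such that the kernel of $\phi_n$ is $\equiv^{\alpha_n}$, and (ii) for all $n$ and $x,y\in X_n$ there are $m\ge n$ and $x',y'\in X_m$ with $\phi_{m,n}(x')=x$, $\phi_{m,n}(y')=y$ and $x'*y'\notin\mathrm{Li}(X_m)$. A vast system of permutative LD-monoids is a vast system in which every $X_n$ is a permutative LD-monoid. Convention: $\mathrm{crit}[X_n]$ is identified with an initial segment of $\mathrm{crit}[X_{n+1}]$ so that $\mathrm{crit}(\phi_n(x))=\mathrm{crit}(x)$ whenever $\phi_n(x)\notin\mathrm{Li}(X_n)$ (and $\max\mathrm{crit}[X_n]=\alpha_n$); $\mathrm{crit}[\mathcal{X}]=\bigcup_n\mathrm{crit}[X_n]$. $\mathrm{EE}(\mathcal{X})$ is the set of threads $(x_n)_n\in\varprojlim X_n$ such that for all $\alpha\in\mathrm{crit}[\mathcal{X}]$ there is $m$ with $\alpha\in\mathrm{crit}[X_m]$ and $x_m^\sharp(\alpha)<\max(\mathrm{crit}[X_m])$. $\mathrm{EE}(\mathcal{X})^+$ is the set of $(x_n)_n\in\mathrm{EE}(\mathcal{X})$ with $x_n\notin\mathrm{Li}(X_n)$ for some $n$. Each $X_n$ is discrete and $\varprojlim X_n$ has the inverse limit topology; operations are coordinatewise. An LD-system is acyclic if there are no $n\ge1$ and $x,x_1,\dots,x_n$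 with $(\cdots((x*x_1)*x_2)\cdots)*x_n=x$. An element $x$ freely generates a sub-LD-system (sub-LD-monoid) if the homomorphism from the free LD-system (LD-monoid) on one generator sending the generator to $x$ is injective. -}

module Defs where

open import Level using (Level; _⊔_) renaming (suc to lsuc)
open import Algebra.Bundles using (Magma)
open import Algebra.Core using (Op₂)
open import Algebra.Structures using (IsMagma; IsMonoid)
open import Algebra.Definitions using (Congruent₂; _DistributesOverˡ_)
open import Algebra.Morphism.Structures using (IsMagmaHomomorphism)
open import Data.List.Base using (foldl; _∷_)
open import Data.Nat.Base using (ℕ; zero; suc; _+_; _<_)
open import Data.Nat.GeneralisedArithmetic using (fold)
open import Data.Product.Base using (Σ; ∃-syntax; ∃₂; Σ-syntax; _×_; _,_; proj₁; proj₂)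
open import Function.Base using (_on_)
open import Function.Bundles using (_⇔_)
open import Function.Definitions using (Injective)
open import Relation.Binary.Core using (Rel)
open import Relation.Binary.Definitions using (Maximum)
open import Relation.Binary.Construct.Closure.Equivalence using (EqClosure)
open import Relation.Nullary.Negation using (¬_)
open import Relation.Unary using (Pred; _∈_; _∉_; _≐_; _∩_; ⋂; Satisfiable)

private variable
  a c ℓ p : Level

record IsLDSystem {A : Set a} (_≈_ : Rel A ℓ) (_*_ : Op₂ A) : Set (a ⊔ ℓ) where
  field
    isMagma : IsMagma _≈_ _*_
    distrib : _DistributesOverˡ_ _≈_ _*_ _*_
  open IsMagma isMagma public renaming (∙-cong to *-cong)

record LDSystem c ℓ : Set (lsuc (c ⊔ ℓ)) where
  infixl 7 _*_
  infix  4 _≈_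
  field
    Carrier    : Set c
    _≈_        : Rel Carrier ℓ
    _*_        : Op₂ Carrier
    isLDSystem : IsLDSystem _≈_ _*_
  open IsLDSystem isLDSystem public

  magma : Magma c ℓ
  magma = record { isMagma = isMagma }

  open Magma magma public using (rawMagma)

record IsLDMonoid {A : Set a} (_≈_ : Rel A ℓ) (_*_ _∘_ : Op₂ A) (1# : A) : Set (a ⊔ ℓ) where
  field
    ∘-isMonoid   : IsMonoid _≈_ _∘_ 1#
    *-cong       : Congruent₂ _≈_ _*_
    ∘-*-action   : ∀ x y z → ((x ∘ y) * z) ≈ (x * (y * z))
    *-distribˡ-∘ : _DistributesOverˡ_ _≈_ _*_ _∘_
    ∘-twist      : ∀ x y → (x ∘ y) ≈ ((x * y) ∘ x)
    *-identityˡ  : ∀ x → (1# * x) ≈ x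
    *-zeroʳ      : ∀ x → (x * 1#) ≈ 1#
  open IsMonoid ∘-isMonoid public renaming (∙-cong to ∘-cong)

record LDMonoid c ℓ : Set (lsuc (c ⊔ ℓ)) where
  infixl 7 _*_ _∘_
  infix  4 _≈_
  field
    Carrier    : Set c
    _≈_        : Rel Carrier ℓ
    _*_        : Op₂ Carrier
    _∘_        : Op₂ Carrier
    1#         : Carrier
    isLDMonoid : IsLDMonoid _≈_ _*_ _∘_ 1#
  open IsLDMonoid isLDMonoid public

module Permutativity (L : LDSystem c ℓ) where
  open LDSystem L

  Li : Pred Carrier (c ⊔ ℓ)
  Li x = ∀ y → x * y ≈ y

  -- Indices are shifted by one: t x y k is t_{k+1}(x,y).
  t : Carrier → Carrier → ℕ → Carrier
  t x y zero          = y
  t x y (suc zero)    = x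
  t x y (suc (suc k)) = t x y (suc k) * t x y k

  record IsPermutative : Set (c ⊔ ℓ) where
    field
      Li-leftIdeal : ∀ x {y} → y ∈ Li → x * y ∈ Li
      t-reaches-Li : ∀ x y → ∃[ k ] t x y k ∈ Li

  IsReduced : Carrier → Set (c ⊔ ℓ)
  IsReduced 1# = ∀ x → x ∈ Li ⇔ x ≈ 1#

  -- The equations that determine ∘ uniquely on a reduced permutative
  -- LD-system with Li = {1#}.
  record IsComposition (_∘_ : Op₂ Carrier) (1# : Carrier) : Set (c ⊔ ℓ) where
    field
      ∘-cong      : Congruent₂ _≈_ _∘_
      ∘-twist     : ∀ x y → (x ∘ y) ≈ ((x * y) ∘ x)
      ∘-identityʳ : ∀ x → (x ∘ 1#) ≈ x

  record IsPermutativeLDMonoid (_∘_ : Op₂ Carrier) (1# : Carrier) : Set (c ⊔ ℓ) where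
    field
      isPermutative : IsPermutative
      isReduced     : IsReduced 1#
      isLDMonoid    : IsLDMonoid _≈_ _*_ _∘_ 1#

  infix 4 _≲_ _∼_ _≺_

  -- crit[L] is represented by Carrier itself, x standing for crit(x):
  -- x ≲ y, x ∼ y and x ≺ y mean crit(x) ≤ crit(y), crit(x) = crit(y) and
  -- crit(x) < crit(y), and the map x^♯ is r ↦ x * r.
  _≲_ : Rel Carrier (c ⊔ ℓ)
  x ≲ y = ∃[ k ] fold y (x *_) k ∈ Li

  _∼_ : Rel Carrier (c ⊔ ℓ)
  x ∼ y = x ≲ y × y ≲ x

  _≺_ : Rel Carrier (c ⊔ ℓ)
  x ≺ y = x ≲ y × ¬ x ∼ y

  BelowMax : Pred Carrier (c ⊔ ℓ)
  BelowMax x = ∃[ μ ] Maximum _≲_ μ × x ≺ μ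

  -- x ≡^α y where α = crit(a); the choice of r is immaterial.
  ModCrit : Carrier → Rel Carrier (c ⊔ ℓ)
  ModCrit a x y = ∃[ r ] r ∼ a × r * r ∈ Li × r * x ≈ r * y

open Permutativity

ClosedUnder : {A : Set a} → Op₂ A → Pred A p → Set (a ⊔ p)
ClosedUnder _∙_ P = ∀ {x y} → x ∈ P → y ∈ P → (x ∙ y) ∈ P

subLDSystem : (L : LDSystem c ℓ) (P : Pred (LDSystem.Carrier L) p) →
              ClosedUnder (LDSystem._*_ L) P → LDSystem (c ⊔ p) ℓ
subLDSystem L P closed = record
  { Carrier    = Σ Carrier P
  ; _≈_        = _≈_ on proj₁
  ; _*_        = λ (x , x∈P) (y , y∈P) → x * y , closed x∈P y∈P
  ; isLDSystem = record
    { isMagma = record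
      { isEquivalence = record { refl = refl ; sym = sym ; trans = trans }
      ; ∙-cong        = *-cong
      }
    ; distrib = λ (x , _) (y , _) (z , _) → distrib x y z
    }
  }
  where open LDSystem L

record IsSubLDMonoid (M : LDMonoid c ℓ) (P : Pred (LDMonoid.Carrier M) p) : Set (c ⊔ p) where
  open LDMonoid M
  field
    *-closed : ClosedUnder _*_ P
    ∘-closed : ClosedUnder _∘_ P
    1-closed : 1# ∈ P

subLDMonoid : (M : LDMonoid c ℓ) (P : Pred (LDMonoid.Carrier M) p) →
              IsSubLDMonoid M P → LDMonoid (c ⊔ p) ℓ
subLDMonoid M P closed = record
  { Carrier    = Σ Carrier P
  ; _≈_        = _≈_ on proj₁
  ; _*_        = λ (x , x∈P) (y , y∈P) → x * y , *-closed x∈P y∈P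
  ; _∘_        = λ (x , x∈P) (y , y∈P) → x ∘ y , ∘-closed x∈P y∈P
  ; 1#         = 1# , 1-closed
  ; isLDMonoid = record
    { ∘-isMonoid = record
      { isSemigroup = record
        { isMagma = record
          { isEquivalence = record { refl = refl ; sym = sym ; trans = trans }
          ; ∙-cong        = ∘-cong
          }
        ; assoc = λ (x , _) (y , _) (z , _) → assoc x y z
        }
      ; identity = (λ (x , _) → identityˡ x) , (λ (x , _) → identityʳ x)
      }
    ; *-cong       = *-cong
    ; ∘-*-action   = λ (x , _) (y , _) (z , _) → ∘-*-action x y z
    ; *-distribˡ-∘ = λ (x , _) (y , _) (z , _) → *-distribˡ-∘ x y z
    ; ∘-twist      = λ (x , _) (y , _) → ∘-twist x y
    ; *-identityˡ  = λ (x , _) → *-identityˡ x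
    ; *-zeroʳ      = λ (x , _) → *-zeroʳ x
    }
  }
  where
  open LDMonoid M
  open IsSubLDMonoid closed

Acyclic : LDSystem c ℓ → Set (c ⊔ ℓ)
Acyclic L = ∀ x x₁ xs → ¬ foldl _*_ x (x₁ ∷ xs) ≈ x
  where open LDSystem L

module FreeLD where

  infixl 7 _*_
  infix  4 _≈_

  data Term : Set where
    gen : Term
    _*_ : Op₂ Term

  data _≈_ : Rel Term Level.zero where
    refl    : ∀ {s} → s ≈ s
    sym     : ∀ {s t} → s ≈ t → t ≈ s
    trans   : ∀ {s t u} → s ≈ t → t ≈ u → s ≈ u
    *-cong  : ∀ {s s′ t t′} → s ≈ s′ → t ≈ t′ → s * t ≈ s′ * t′
    distrib : ∀ s t u → s * (t * u) ≈ (s * t) * (s * u)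

  free : LDSystem Level.zero Level.zero
  free = record
    { _≈_        = _≈_
    ; _*_        = _*_
    ; isLDSystem = record
      { isMagma = record
        { isEquivalence = record { refl = refl ; sym = sym ; trans = trans }
        ; ∙-cong        = *-cong
        }
      ; distrib = distrib
      }
    }

  module _ (L : LDSystem c ℓ) (x : LDSystem.Carrier L) where
    private module L = LDSystem L

    eval : Term → L.Carrier
    eval gen     = x
    eval (s * t) = eval s L.* eval t

    eval-cong : ∀ {s t} → s ≈ t → eval s L.≈ eval t
    eval-cong refl            = L.refl
    eval-cong (sym e)         = L.sym (eval-cong e)
    eval-cong (trans e f)     = L.trans (eval-cong e) (eval-cong f)
    eval-cong (*-cong e f)    = L.*-cong (eval-cong e) (eval-cong f)
    eval-cong (distrib s t u) = L.distrib (eval s) (eval t) (eval u)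

    eval-isHomomorphism : IsMagmaHomomorphism (LDSystem.rawMagma free) L.rawMagma eval
    eval-isHomomorphism = record
      { isRelHomomorphism = record { cong = eval-cong }
      ; homo              = λ _ _ → L.refl
      }

    FreelyGenerates : Set ℓ
    FreelyGenerates = Injective _≈_ L._≈_ eval

module FreeLDMonoid where

  infixl 7 _*_ _∘_
  infix  4 _≈_

  data Term : Set where
    gen : Term
    1#  : Term
    _*_ : Op₂ Term
    _∘_ : Op₂ Term

  data _≈_ : Rel Term Level.zero where
    refl         : ∀ {s} → s ≈ s
    sym          : ∀ {s t} → s ≈ t → t ≈ s
    trans        : ∀ {s t u} → s ≈ t → t ≈ u → s ≈ u
    *-cong       : ∀ {s s′ t t′} → s ≈ s′ → t ≈ t′ → s * t ≈ s′ * t′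
    ∘-cong       : ∀ {s s′ t t′} → s ≈ s′ → t ≈ t′ → s ∘ t ≈ s′ ∘ t′
    ∘-assoc      : ∀ s t u → (s ∘ t) ∘ u ≈ s ∘ (t ∘ u)
    ∘-identityˡ  : ∀ s → 1# ∘ s ≈ s
    ∘-identityʳ  : ∀ s → s ∘ 1# ≈ s
    ∘-*-action   : ∀ s t u → (s ∘ t) * u ≈ s * (t * u)
    *-distribˡ-∘ : ∀ s t u → s * (t ∘ u) ≈ (s * t) ∘ (s * u)
    ∘-twist      : ∀ s t → s ∘ t ≈ (s * t) ∘ s
    *-identityˡ  : ∀ s → 1# * s ≈ s
    *-zeroʳ      : ∀ s → s * 1# ≈ 1#

  free : LDMonoid Level.zero Level.zero
  free = record
    { _≈_        = _≈_
    ; _*_        = _*_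
    ; _∘_        = _∘_
    ; 1#         = 1#
    ; isLDMonoid = record
      { ∘-isMonoid = record
        { isSemigroup = record
          { isMagma = record
            { isEquivalence = record { refl = refl ; sym = sym ; trans = trans }
            ; ∙-cong        = ∘-cong
            }
          ; assoc = ∘-assoc
          }
        ; identity = ∘-identityˡ , ∘-identityʳ
        }
      ; *-cong       = *-cong
      ; ∘-*-action   = ∘-*-action
      ; *-distribˡ-∘ = *-distribˡ-∘
      ; ∘-twist      = ∘-twist
      ; *-identityˡ  = *-identityˡ
      ; *-zeroʳ      = *-zeroʳ
      }
    }

  module _ (M : LDMonoid c ℓ) (x : LDMonoid.Carrier M) where
    private module M = LDMonoid M

    eval : Term → M.Carrier
    eval gen     = x
    eval 1#      = M.1#
    eval (s * t) = eval s M.* eval t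
    eval (s ∘ t) = eval s M.∘ eval t

    eval-cong : ∀ {s t} → s ≈ t → eval s M.≈ eval t
    eval-cong refl                 = M.refl
    eval-cong (sym e)              = M.sym (eval-cong e)
    eval-cong (trans e f)          = M.trans (eval-cong e) (eval-cong f)
    eval-cong (*-cong e f)         = M.*-cong (eval-cong e) (eval-cong f)
    eval-cong (∘-cong e f)         = M.∘-cong (eval-cong e) (eval-cong f)
    eval-cong (∘-assoc s t u)      = M.assoc (eval s) (eval t) (eval u)
    eval-cong (∘-identityˡ s)      = M.identityˡ (eval s)
    eval-cong (∘-identityʳ s)      = M.identityʳ (eval s)
    eval-cong (∘-*-action s t u)   = M.∘-*-action (eval s) (eval t) (eval u)
    eval-cong (*-distribˡ-∘ s t u) = M.*-distribˡ-∘ (eval s) (eval t) (eval u)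
    eval-cong (∘-twist s t)        = M.∘-twist (eval s) (eval t)
    eval-cong (*-identityˡ s)      = M.*-identityˡ (eval s)
    eval-cong (*-zeroʳ s)          = M.*-zeroʳ (eval s)

    FreelyGenerates : Set ℓ
    FreelyGenerates = Injective _≈_ M._≈_ eval

record InverseSystem c ℓ : Set (lsuc (c ⊔ ℓ)) where
  field
    X                : ℕ → LDSystem c ℓ
    isPermutative    : ∀ n → IsPermutative (X n)

  module X n = LDSystem (X n)

  field
    φ                : ∀ n → X.Carrier (suc n) → X.Carrier n
    φ-isHomomorphism : ∀ n → IsMagmaHomomorphism (X.rawMagma (suc n)) (X.rawMagma n) (φ n)

  -- φ* k n is φ_{m,n} for m = k + n.
  φ* : ∀ k n → X.Carrier (k + n) → X.Carrier n
  φ* zero    n x = x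
  φ* (suc k) n x = φ* k n (φ (k + n) x)

record IsVast (𝒳 : InverseSystem c ℓ) : Set (c ⊔ ℓ) where
  open InverseSystem 𝒳
  field
    -- crit(α n) is the critical point α_n ∈ crit[X_{n+1}].
    α      : ∀ n → X.Carrier (suc n)
    kernel : ∀ n x y → X._≈_ n (φ n x) (φ n y) ⇔ ModCrit (X (suc n)) (α n) x y
    nonLi  : ∀ n x y → ∃[ k ] ∃₂ λ x′ y′ →
             X._≈_ n (φ* k n x′) x × X._≈_ n (φ* k n y′) y ×
             X._*_ (k + n) x′ y′ ∉ Li (X (k + n))

module Product (𝒳 : InverseSystem c ℓ) where
  open InverseSystem 𝒳

  Seq : Set c
  Seq = ∀ n → X.Carrier n

  pointwise : (∀ n → Op₂ (X.Carrier n)) → Op₂ Seq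
  pointwise op x y n = op n (x n) (y n)

  ∏X : LDSystem c ℓ
  ∏X = record
    { Carrier    = Seq
    ; _≈_        = λ x y → ∀ n → X._≈_ n (x n) (y n)
    ; _*_        = pointwise X._*_
    ; isLDSystem = record
      { isMagma = record
        { isEquivalence = record
          { refl  = λ n → X.refl n
          ; sym   = λ e n → X.sym n (e n)
          ; trans = λ e f n → X.trans n (e n) (f n)
          }
        ; ∙-cong = λ e f n → X.*-cong n (e n) (f n)
        }
      ; distrib = λ x y z n → X.distrib n (x n) (y n) (z n)
      }
    }

  ∏M : (comp : ∀ n → Op₂ (X.Carrier n)) (1# : Seq) →
       (∀ n → IsPermutativeLDMonoid (X n) (comp n) (1# n)) → LDMonoid c ℓ
  ∏M comp 1# isPLDM = record
    { Carrier    = Seq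
    ; _≈_        = LDSystem._≈_ ∏X
    ; _*_        = LDSystem._*_ ∏X
    ; _∘_        = pointwise comp
    ; 1#         = 1#
    ; isLDMonoid = record
      { ∘-isMonoid = record
        { isSemigroup = record
          { isMagma = record
            { isEquivalence = LDSystem.isEquivalence ∏X
            ; ∙-cong        = λ e f n → M.∘-cong n (e n) (f n)
            }
          ; assoc = λ x y z n → M.assoc n (x n) (y n) (z n)
          }
        ; identity = (λ x n → M.identityˡ n (x n)) , (λ x n → M.identityʳ n (x n))
        }
      ; *-cong       = LDSystem.*-cong ∏X
      ; ∘-*-action   = λ x y z n → M.∘-*-action n (x n) (y n) (z n)
      ; *-distribˡ-∘ = λ x y z n → M.*-distribˡ-∘ n (x n) (y n) (z n)
      ; ∘-twist      = λ x y n → M.∘-twist n (x n) (y n)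
      ; *-identityˡ  = λ x n → M.*-identityˡ n (x n)
      ; *-zeroʳ      = λ x n → M.*-zeroʳ n (x n)
      }
    }
    where
    module M n = IsLDMonoid (IsPermutativeLDMonoid.isLDMonoid (isPLDM n))

  Subset : Set (lsuc (c ⊔ ℓ))
  Subset = Pred Seq (c ⊔ ℓ)

  -- The product topology with each X_n discrete: the sequences agreeing with
  -- x below n form a neighbourhood base at x.
  Open : Subset → Set (c ⊔ ℓ)
  Open W = ∀ x → x ∈ W → ∃[ n ] ∀ y → (∀ i → i < n → X._≈_ i (y i) (x i)) → y ∈ W

  OpenIn : Subset → Subset → Set (lsuc (c ⊔ ℓ))
  OpenIn S A = ∃[ W ] Open W × A ≐ (S ∩ W)

  GδIn : Subset → Subset → Set (lsuc (c ⊔ ℓ))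
  GδIn S A = Σ[ V ∈ (ℕ → Subset) ] (∀ i → OpenIn S (V i)) × A ≐ ⋂ ℕ V

  DenseIn : Subset → Subset → Set (lsuc (c ⊔ ℓ))
  DenseIn S A = ∀ U → OpenIn S U → Satisfiable U → Satisfiable (U ∩ A)

module Limit (𝒳 : InverseSystem c ℓ) (vast : IsVast 𝒳) where
  open InverseSystem 𝒳 public
  open IsVast vast
  open Product 𝒳 public

  -- lim X_n, with the subspace topology from the product.
  Lim : Subset
  Lim x = Level.Lift (c ⊔ ℓ) (∀ n → X._≈_ n (φ n (x (suc n))) (x n))

  -- crit[𝒳] is the disjoint union of the crit[X_n], (n , a) standing for
  -- crit(a) ∈ crit[X_n], modulo the identification of crit[X_n] with an
  -- initial segment of crit[X_{n+1}].
  Crit : Set c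
  Crit = Σ[ n ∈ ℕ ] X.Carrier n

  data Identified : Rel Crit (c ⊔ ℓ) where
    same : ∀ {n a b} → _∼_ (X n) a b → Identified (n , a) (n , b)
    lift : ∀ {n} x → φ n x ∉ Li (X n) → Identified (n , φ n x) (suc n , x)
    top  : ∀ {n a} → Maximum (_≲_ (X n)) a → Identified (n , a) (suc n , α n)

  infix 4 _≈crit_
  _≈crit_ : Rel Crit (c ⊔ ℓ)
  _≈crit_ = EqClosure Identified

  -- m and r witness β ∈ crit[X_m] with β = crit(r), so that
  -- x_m^♯(β) = crit(x_m * r).
  EE : Subset
  EE x = x ∈ Lim × (∀ β → ∃₂ λ m r → β ≈crit (m , r) × BelowMax (X m) (X._*_ m (x m) r))

  EE⁺ : Subset
  EE⁺ x = x ∈ EE × (∃[ n ] x n ∉ Li (X n))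

{-# OPTIONS --safe #-}
module Submission where

-- By the kernel condition, φ x ≲ φ y iff x ≲ y or α ≲ y, so crit[X_n] embeds
-- in crit[X_{n+1}], and x ∈ EE iff for every α in crit[X_n] some later x_N
-- moves the image of α to a non-maximal point.  Applying the second vastness
-- condition to an element z and an element of Li lifts z to a z′ which keeps
-- the former maximum below the new one; iterating this gives density.
--
-- A cycle x = (⋯(x * x₁) * ⋯) * xₙ in EE⁺ would be visible in some X_N with
-- all its partial products outside Li.  This is impossible in a permutative
-- LD-system: the partial product m with the largest critical point would be
-- congruent to some m * z modulo a larger critical point, but crit(m) is not in
-- the range of m^♯.  Acyclicity implies freeness because two elements of the
-- free LD-system on one generator are equal or comparable for left division.

open import Defs
open import Level using (Level; _⊔_; 0ℓ; lift)
open import Algebra.Core using (Op₂)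
open import Algebra.Morphism.Structures using (IsMagmaHomomorphism)
open import Axiom.ExcludedMiddle using (ExcludedMiddle)
open import Data.Empty using (⊥-elim)
open import Data.List.Base using (List; []; _∷_; _++_; _∷ʳ_; [_]; foldl; foldr; map)
open import Data.List.Properties using (foldl-∷ʳ)
open import Data.Nat.Base as ℕ
  using (ℕ; zero; suc; _+_; _≤_; _≤′_; ≤′-step; _<_; z≤n; s≤s)
open import Data.Nat.GeneralisedArithmetic using (fold; fold-+; iterate)
open import Data.Nat.Properties as ℕ using (_≟_)
open import Data.Product.Base
  using (Σ; Σ-syntax; ∃₂; ∃-syntax; _×_; _,_; proj₁; proj₂)
open import Data.Sum.Base using (_⊎_; inj₁; inj₂; [_,_]′)
open import Function.Base using (_∘′_; id)
open import Function.Bundles using (module Equivalence)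
open import Relation.Binary.Bundles using (Setoid)
open import Relation.Binary.Core using (Rel)
open import Relation.Binary.Construct.Closure.ReflexiveTransitive
  using (Star; ε; _◅_; _◅◅_; gmap; kleisliStar)
open import Relation.Binary.Construct.Closure.Symmetric using (fwd; bwd)
open import Relation.Binary.Definitions using (Maximum)
open import Relation.Binary.PropositionalEquality as ≡ using (_≡_)
open import Relation.Nullary.Decidable using (yes; no; decidable-stable)
open import Relation.Nullary.Negation using (¬_; contradiction)
open import Relation.Unary using (Pred; _∈_; _∉_)
import Relation.Binary.Reasoning.Setoid as SetoidReasoning

open Equivalence using (to; from)

-- Confluence of expansions s * (t * u) ⟶ (s * t) * (s * u)

module Expansion where
  open FreeLD

  private variable
    s s′ t t′ u : Term

  infix 4 _⟶_ _⟶*_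

  data _⟶_ : Rel Term 0ℓ where
    expand : ∀ s t u → s * (t * u) ⟶ (s * t) * (s * u)
    left   : s ⟶ s′ → s * t ⟶ s′ * t
    right  : t ⟶ t′ → s * t ⟶ s * t′

  _⟶*_ : Rel Term 0ℓ
  _⟶*_ = Star _⟶_

  *-mono : s ⟶* s′ → t ⟶* t′ → s * t ⟶* s′ * t′
  *-mono p q = gmap (_* _) left p ◅◅ gmap (_ *_) right q

  ⟶⇒≈ : s ⟶ t → s ≈ t
  ⟶⇒≈ (expand s t u) = distrib s t u
  ⟶⇒≈ (left p)       = *-cong (⟶⇒≈ p) refl
  ⟶⇒≈ (right p)      = *-cong refl (⟶⇒≈ p)

  infixl 7 _⊛_

  -- `s ⊛_` substitutes `s * gen` for every leaf, that is, distributes `s` completely; being a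
  -- substitution, it preserves expansions.
  _⊛_ : Op₂ Term
  s ⊛ gen     = s * gen
  s ⊛ (t * u) = (s ⊛ t) * (s ⊛ u)

  -- ∂ t is a common expansion of all one-step expansions of t.
  ∂ : Term → Term
  ∂ gen     = gen
  ∂ (s * t) = ∂ s ⊛ ∂ t

  *⟶*⊛ : ∀ s t → s * t ⟶* s ⊛ t
  *⟶*⊛ s gen     = ε
  *⟶*⊛ s (t * u) = expand s t u ◅ *-mono (*⟶*⊛ s t) (*⟶*⊛ s u)

  ⊛-monoˡ : s ⟶* s′ → ∀ t → s ⊛ t ⟶* s′ ⊛ t
  ⊛-monoˡ p gen     = *-mono p ε
  ⊛-monoˡ p (t * u) = *-mono (⊛-monoˡ p t) (⊛-monoˡ p u)

  ⊛-monoʳ : ∀ s → t ⟶* t′ → s ⊛ t ⟶* s ⊛ t′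
  ⊛-monoʳ s = kleisliStar (s ⊛_) step
    where
    step : t ⟶ t′ → s ⊛ t ⟶* s ⊛ t′
    step (expand a b c) = expand (s ⊛ a) (s ⊛ b) (s ⊛ c) ◅ ε
    step (left p)       = *-mono (step p) ε
    step (right p)      = *-mono ε (step p)

  ⊛-mono : s ⟶* s′ → t ⟶* t′ → s ⊛ t ⟶* s′ ⊛ t′
  ⊛-mono p q = ⊛-monoˡ p _ ◅◅ ⊛-monoʳ _ q

  -- At a leaf `u` the left side is only `(s ⊛ t) * (s * gen)`, which must be expanded further.
  ⊛-distrib : ∀ s t u → s ⊛ (t ⊛ u) ⟶* (s ⊛ t) ⊛ (s ⊛ u)
  ⊛-distrib s t gen     = *⟶*⊛ (s ⊛ t) (s * gen)
  ⊛-distrib s t (u * v) = *-mono (⊛-distrib s t u) (⊛-distrib s t v)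

  ⟶*∂ : ∀ t → t ⟶* ∂ t
  ⟶*∂ gen     = ε
  ⟶*∂ (s * t) = *-mono (⟶*∂ s) (⟶*∂ t) ◅◅ *⟶*⊛ (∂ s) (∂ t)

  ⟶-∂ : s ⟶ t → t ⟶* ∂ s
  ⟶-∂ (expand s t u) =
    -- The two expanded factors form `∂ s ⊛ (∂ t * ∂ u)` by definition of `⊛`; then the inner
    -- product is expanded.
    *-mono (*-mono (⟶*∂ s) (⟶*∂ t) ◅◅ *⟶*⊛ (∂ s) (∂ t))
           (*-mono (⟶*∂ s) (⟶*∂ u) ◅◅ *⟶*⊛ (∂ s) (∂ u))
    ◅◅ ⊛-monoʳ (∂ s) (*⟶*⊛ (∂ t) (∂ u))
  ⟶-∂ {s * t} (left p)  = *-mono (⟶-∂ p) (⟶*∂ t) ◅◅ *⟶*⊛ (∂ s) (∂ t)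
  ⟶-∂ {s * t} (right p) = *-mono (⟶*∂ s) (⟶-∂ p) ◅◅ *⟶*⊛ (∂ s) (∂ t)

  ∂-mono : s ⟶* t → ∂ s ⟶* ∂ t
  ∂-mono = kleisliStar ∂ step
    where
    step : s ⟶ t → ∂ s ⟶* ∂ t
    step (expand s t u) = ⊛-distrib (∂ s) (∂ t) (∂ u)
    step (left p)       = ⊛-mono (step p) ε
    step (right p)      = ⊛-mono ε (step p)

  ∂^ : ℕ → Term → Term
  ∂^ k t = iterate ∂ t k

  ∂^-mono : ∀ k → s ⟶* t → ∂^ k s ⟶* ∂^ k t
  ∂^-mono zero    p = p
  ∂^-mono (suc k) p = ∂^-mono k (∂-mono p)

  ⟶*∂^ : ∀ k t → t ⟶* ∂^ k t
  ⟶*∂^ zero    t = ε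
  ⟶*∂^ (suc k) t = ⟶*∂ t ◅◅ ⟶*∂^ k (∂ t)

  -- One `∂` overtakes one step and `∂^` is monotone, so `k` is the number of steps.
  ∂^-cofinal : s ⟶* t → ∃[ k ] t ⟶* ∂^ k s
  ∂^-cofinal ε       = 0 , ε
  ∂^-cofinal (p ◅ q) = let k , r = ∂^-cofinal q in suc k , r ◅◅ ∂^-mono k (⟶-∂ p)

  confluent : s ⟶* t → s ⟶* u → ∃[ v ] t ⟶* v × u ⟶* v
  confluent {s} p q =
    let j , p′ = ∂^-cofinal p
        k , q′ = ∂^-cofinal q
    in ∂^ k (∂^ j s) , p′ ◅◅ ⟶*∂^ k _ , q′ ◅◅ ∂^-mono k (⟶*∂^ j s)

  commonExpansion : s ≈ t → ∃[ v ] s ⟶* v × t ⟶* v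
  commonExpansion refl = _ , ε , ε
  commonExpansion (sym e) = let v , p , q = commonExpansion e in v , q , p
  commonExpansion (trans e f) =
    let _ , p , q   = commonExpansion e
        _ , p′ , q′ = commonExpansion f
        v , r , r′  = confluent q p′
    in v , p ◅◅ r , q′ ◅◅ r′
  commonExpansion (*-cong e f) =
    let _ , p , q   = commonExpansion e
        _ , p′ , q′ = commonExpansion f
    in _ , *-mono p p′ , *-mono q q′
  commonExpansion (distrib s t u) = _ , expand s t u ◅ ε , ε

-- Comparison of elements of the free LD-system on one generator

module Comparison where
  open FreeLD
  open Expansion

  private variable
    s s′ t t′ w : Term

  data Spine (s : Term) : Term → Set where
    here : Spine s s
    left : Spine s t → Spine s (t * t′)

  -- An expansion at the root only moves the left factor and its spine one place deeper.
  Spine-⟶ : t ⟶ t′ → Spine s t → ∃[ s′ ] Spine s′ t′ × s ≈ s′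
  Spine-⟶ p              here     = _ , here , ⟶⇒≈ p
  Spine-⟶ (expand _ _ _) (left q) = _ , left (left q) , refl
  Spine-⟶ (left p)       (left q) = let s′ , q′ , e = Spine-⟶ p q in s′ , left q′ , e
  Spine-⟶ (right p)      (left q) = _ , left q , refl

  Spine-⟶* : t ⟶* t′ → Spine s t → ∃[ s′ ] Spine s′ t′ × s ≈ s′
  Spine-⟶* ε       q = _ , q , refl
  Spine-⟶* (p ◅ r) q =
    let _ , q′ , e   = Spine-⟶ p q
        s″ , q″ , e′ = Spine-⟶* r q′
    in s″ , q″ , trans e e′

  Spine-total : Spine s w → Spine t w → Spine s t ⊎ Spine t s
  Spine-total p        here     = inj₁ p
  Spine-total here     (left q) = inj₂ (left q)
  Spine-total (left p) (left q) = Spine-total p q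

  infix 4 _<ᴸ_
  _<ᴸ_ : Rel Term 0ℓ
  s <ᴸ t = ∃₂ λ u us → foldl _*_ s (u ∷ us) ≈ t

  Spine⇒≤ᴸ : Spine s t → s ≈ t ⊎ s <ᴸ t
  Spine⇒≤ᴸ here = inj₁ refl
  Spine⇒≤ᴸ (left {t′ = v} p) with Spine⇒≤ᴸ p
  ... | inj₁ e            = inj₂ (v , [] , *-cong e refl)
  ... | inj₂ (u , us , e) = inj₂ (u , us ∷ʳ v ,
    ≡.subst (_≈ _) (≡.sym (foldl-∷ʳ _*_ _ v us)) (*-cong e refl))

  foldl-congˡ : ∀ us → s ≈ s′ → foldl _*_ s us ≈ foldl _*_ s′ us
  foldl-congˡ []       e = e
  foldl-congˡ (u ∷ us) e = foldl-congˡ us (*-cong e refl)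

  ≤ᴸ-resp : s ≈ s′ → t ≈ t′ → s′ ≈ t′ ⊎ s′ <ᴸ t′ → s ≈ t ⊎ s <ᴸ t
  ≤ᴸ-resp e f (inj₁ g)            = inj₁ (trans e (trans g (sym f)))
  ≤ᴸ-resp e f (inj₂ (u , us , g)) =
    inj₂ (u , us , trans (foldl-congˡ (u ∷ us) e) (trans g (sym f)))

  gen^ : ℕ → Term
  gen^ n = fold gen (gen *_) n

  -- With g(i) for `gen^ i` and i large, `(s * t) * g(i+1)` is `(s * t) * (s * g(i))`, hence
  -- `s * (t * g(i))`, hence g(i+2). The first rewriting costs the `suc` in the bound.
  absorbs : ∀ t → ∃[ n ] ∀ k → t * gen^ (k + n) ≈ gen^ (suc (k + n))
  absorbs gen     = 0 , λ _ → refl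
  absorbs (s * t) =
    let m , p = absorbs s
        n , q = absorbs t
        p′ : ∀ k → s * gen^ (k + (m + n)) ≈ gen^ (suc (k + (m + n)))
        p′ k = ≡.subst (λ i → s * gen^ i ≈ gen^ (suc i))
                 (≡.trans (ℕ.+-assoc k n m) (≡.cong (k +_) (ℕ.+-comm n m))) (p (k + n))
        q′ : ∀ k → t * gen^ (k + (m + n)) ≈ gen^ (suc (k + (m + n)))
        q′ k = ≡.subst (λ i → t * gen^ i ≈ gen^ (suc i)) (ℕ.+-assoc k m n) (q (k + m))
    in suc (m + n) , λ k → ≡.subst (λ i → (s * t) * gen^ i ≈ gen^ (suc i))
         (≡.sym (ℕ.+-suc k (m + n)))
         (trans (*-cong refl (sym (p′ k)))
         (trans (sym (distrib s t (gen^ (k + (m + n)))))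
         (trans (*-cong refl (q′ k)) (p′ (suc k)))))

  -- Both s and t are left divisors of one right power of the generator.
  comparison : ∀ s t → s ≈ t ⊎ (s <ᴸ t ⊎ t <ᴸ s)
  comparison s t =
    let m , p = absorbs s
        n , q = absorbs t
        e : s * gen^ (n + m) ≈ t * gen^ (n + m)
        e = trans (p n) (sym (≡.subst (λ i → t * gen^ i ≈ gen^ (suc i)) (ℕ.+-comm m n) (q m)))
        _ , v , v′ = commonExpansion e
        _ , r , f  = Spine-⟶* v (left here)
        _ , r′ , g = Spine-⟶* v′ (left here)
    in [ [ inj₁ , inj₂ ∘′ inj₁ ]′ ∘′ ≤ᴸ-resp f g ∘′ Spine⇒≤ᴸ
       , [ inj₁ ∘′ sym , inj₂ ∘′ inj₂ ]′ ∘′ ≤ᴸ-resp g f ∘′ Spine⇒≤ᴸ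
       ]′ (Spine-total r r′)

module _ {c ℓ} (L : LDSystem c ℓ) where
  open LDSystem L
  open Comparison using (_<ᴸ_; comparison)

  private
    evalL : LDSystem.Carrier L → FreeLD.Term → LDSystem.Carrier L
    evalL = FreeLD.eval L

  eval-foldl : ∀ x s us →
    FreeLD.eval L x (foldl FreeLD._*_ s us) ≡ foldl _*_ (evalL x s) (map (evalL x) us)
  eval-foldl x s []       = ≡.refl
  eval-foldl x s (u ∷ us) = eval-foldl x (s FreeLD.* u) us

  acyclic⇒free : Acyclic L → ∀ x → FreeLD.FreelyGenerates L x
  acyclic⇒free acyclic x {s} {t} e =
    [ id , ⊥-elim ∘′ [ (λ s<t → <⇒≉ s<t e) , (λ t<s → <⇒≉ t<s (sym e)) ]′ ]′ (comparison s t)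
    where
    <⇒≉ : ∀ {s t} → s <ᴸ t → ¬ evalL x s ≈ evalL x t
    <⇒≉ {s} (u , us , f) e = acyclic (evalL x s) (evalL x u) (map (evalL x) us)
      (trans (reflexive (≡.sym (eval-foldl x s (u ∷ us))))
             (trans (FreeLD.eval-cong L x f) (sym e)))

-- The free LD-monoid on one generator

-- F (a₁ * (a₂ * ⋯ (aₙ * gen))) = a₁ ∘ ⋯ ∘ aₙ is well defined on the free
-- LD-system, and a left inverse of p ↦ p * gen on the free LD-monoid; so an
-- evaluation is injective on monoid terms once it is injective on LD-terms.
module MonoidTerms where
  open FreeLDMonoid

  private
    module T = FreeLD
    setoid : Setoid 0ℓ 0ℓ
    setoid = record
      { Carrier       = Term
      ; _≈_           = _≈_
      ; isEquivalence = record { refl = refl ; sym = sym ; trans = trans }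
      }

  open SetoidReasoning setoid

  *-distribˡ-* : ∀ s t u → s * (t * u) ≈ (s * t) * (s * u)
  *-distribˡ-* s t u = begin
    s * (t * u)       ≈⟨ sym (∘-*-action s t u) ⟩
    (s ∘ t) * u       ≈⟨ *-cong (∘-twist s t) refl ⟩
    ((s * t) ∘ s) * u ≈⟨ ∘-*-action (s * t) s u ⟩
    (s * t) * (s * u) ∎

  embed : T.Term → Term
  embed T.gen     = gen
  embed (s T.* t) = embed s * embed t

  embed-cong : ∀ {s t} → s T.≈ t → embed s ≈ embed t
  embed-cong T.refl            = refl
  embed-cong (T.sym e)         = sym (embed-cong e)
  embed-cong (T.trans e f)     = trans (embed-cong e) (embed-cong f)
  embed-cong (T.*-cong e f)    = *-cong (embed-cong e) (embed-cong f)
  embed-cong (T.distrib s t u) = *-distribˡ-* (embed s) (embed t) (embed u)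

  F : T.Term → Term
  F T.gen     = 1#
  F (s T.* t) = embed s ∘ F t

  F-cong : ∀ {s t} → s T.≈ t → F s ≈ F t
  F-cong T.refl            = refl
  F-cong (T.sym e)         = sym (F-cong e)
  F-cong (T.trans e f)     = trans (F-cong e) (F-cong f)
  F-cong (T.*-cong e f)    = ∘-cong (embed-cong e) (F-cong f)
  F-cong (T.distrib s t u) = begin
    embed s ∘ (embed t ∘ F u)             ≈⟨ sym (∘-assoc (embed s) (embed t) (F u)) ⟩
    (embed s ∘ embed t) ∘ F u             ≈⟨ ∘-cong (∘-twist (embed s) (embed t)) refl ⟩
    ((embed s * embed t) ∘ embed s) ∘ F u ≈⟨ ∘-assoc (embed s * embed t) (embed s) (F u) ⟩
    (embed s * embed t) ∘ (embed s ∘ F u) ∎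

  act : List T.Term → T.Term → T.Term
  act as t = foldr T._*_ t as

  -- Every monoid term is a product of LD-terms; in `p * q` the whole of `p` acts on each factor of
  -- `q`.
  factors : Term → List T.Term
  factors gen     = [ T.gen ]
  factors 1#      = []
  factors (p * q) = map (act (factors p)) (factors q)
  factors (p ∘ q) = factors p ++ factors q

  ∏ : List T.Term → Term
  ∏ []       = 1#
  ∏ (a ∷ as) = embed a ∘ ∏ as

  ∏-++ : ∀ as bs → ∏ (as ++ bs) ≈ ∏ as ∘ ∏ bs
  ∏-++ []       bs = sym (∘-identityˡ (∏ bs))
  ∏-++ (a ∷ as) bs = trans (∘-cong refl (∏-++ as bs)) (sym (∘-assoc (embed a) (∏ as) (∏ bs)))

  embed-act : ∀ as t → embed (act as t) ≈ ∏ as * embed t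
  embed-act []       t = sym (*-identityˡ (embed t))
  embed-act (a ∷ as) t =
    trans (*-cong refl (embed-act as t)) (sym (∘-*-action (embed a) (∏ as) (embed t)))

  ∏-map-act : ∀ as bs → ∏ (map (act as) bs) ≈ ∏ as * ∏ bs
  ∏-map-act as []       = sym (*-zeroʳ (∏ as))
  ∏-map-act as (b ∷ bs) =
    trans (∘-cong (embed-act as b) (∏-map-act as bs)) (sym (*-distribˡ-∘ (∏ as) (embed b) (∏ bs)))

  ∏-factors : ∀ p → ∏ (factors p) ≈ p
  ∏-factors gen     = ∘-identityʳ gen
  ∏-factors 1#      = refl
  ∏-factors (p * q) =
    trans (∏-map-act (factors p) (factors q)) (*-cong (∏-factors p) (∏-factors q))
  ∏-factors (p ∘ q) =
    trans (∏-++ (factors p) (factors q)) (∘-cong (∏-factors p) (∏-factors q))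

  F-act : ∀ as → F (act as T.gen) ≡ ∏ as
  F-act []       = ≡.refl
  F-act (a ∷ as) = ≡.cong (embed a ∘_) (F-act as)

  module _ {c ℓ} (M : LDMonoid c ℓ) (x : LDMonoid.Carrier M) where
    private module M = LDMonoid M

    free-if-free-on-LD-terms :
      (∀ s t → eval M x (embed s) M.≈ eval M x (embed t) → s T.≈ t) →
      FreelyGenerates M x
    free-if-free-on-LD-terms inj {p} {q} e = begin
      p                             ≈⟨ sym (∏-factors p) ⟩
      ∏ (factors p)                 ≡⟨ ≡.sym (F-act (factors p)) ⟩
      F (act (factors p) T.gen)     ≈⟨ F-cong (inj _ _ e′) ⟩
      F (act (factors q) T.gen)     ≡⟨ F-act (factors q) ⟩
      ∏ (factors q)                 ≈⟨ ∏-factors q ⟩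
      q                             ∎
      where
      eval-act : ∀ r → eval M x (embed (act (factors r) T.gen)) M.≈ eval M x r M.* x
      eval-act r = eval-cong M x (trans (embed-act (factors r) T.gen) (*-cong (∏-factors r) refl))

      e′ : eval M x (embed (act (factors p) T.gen)) M.≈ eval M x (embed (act (factors q) T.gen))
      e′ = M.trans (eval-act p) (M.trans (M.*-cong e M.refl) (M.sym (eval-act q)))

-- Critical points in permutative LD-systems

module PermutativeTheory {c ℓ} (L : LDSystem c ℓ)
                         (isPermutative : Permutativity.IsPermutative L) where
  open LDSystem L
  open Permutativity L
  open Permutativity.IsPermutative isPermutative public
  open SetoidReasoning setoid

  private variable
    a b x x′ y y′ z z′ : Carrier

  Li-resp : x ≈ y → x ∈ Li → y ∈ Li
  Li-resp e x∈Li z = trans (*-cong (sym e) refl) (x∈Li z)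

  infixr 8 _^[_]_
  _^[_]_ : Carrier → ℕ → Carrier → Carrier
  x ^[ k ] y = fold y (x *_) k

  ^-cong : x ≈ x′ → y ≈ y′ → ∀ k → x ^[ k ] y ≈ x′ ^[ k ] y′
  ^-cong e f zero    = f
  ^-cong e f (suc k) = *-cong e (^-cong e f k)

  ^-+ : ∀ x j k y → x ^[ j + k ] y ≈ x ^[ j ] (x ^[ k ] y)
  ^-+ x j k y = reflexive (fold-+ y (x *_) j)

  ^-+′ : ∀ x j k y → x ^[ j + k ] y ≈ x ^[ k ] (x ^[ j ] y)
  ^-+′ x j k y = trans (reflexive (≡.cong (x ^[_] y) (ℕ.+-comm j k))) (^-+ x k j y)

  ^-suc : ∀ x k y → x ^[ suc k ] y ≈ x ^[ k ] (x * y)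
  ^-suc x k y = ^-+′ x 1 k y

  ^-* : ∀ x k y z → x ^[ k ] (y * z) ≈ x ^[ k ] y * x ^[ k ] z
  ^-* x zero    y z = refl
  ^-* x (suc k) y z = trans (*-cong refl (^-* x k y z)) (distrib x _ _)

  ^-^ : ∀ x k y j z → x ^[ k ] (y ^[ j ] z) ≈ (x ^[ k ] y) ^[ j ] (x ^[ k ] z)
  ^-^ x k y zero    z = refl
  ^-^ x k y (suc j) z = trans (^-* x k y _) (*-cong refl (^-^ x k y j z))

  Li-^ : x ∈ Li → ∀ k y → x ^[ k ] y ≈ y
  Li-^ x∈Li zero    y = refl
  Li-^ x∈Li (suc k) y = trans (x∈Li _) (Li-^ x∈Li k y)

  ^-Li : ∀ k → y ∈ Li → x ^[ k ] y ∈ Li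
  ^-Li zero    y∈Li = y∈Li
  ^-Li (suc k) y∈Li = Li-leftIdeal _ (^-Li k y∈Li)

  -- `x * (x * w) = (x * x) * (x * w) = x * w`. This is why `ModCrit` can do without iterates.
  *-^ : x * x ∈ Li → ∀ k y → x * x ^[ k ] y ≈ x * y
  *-^ xx∈Li zero    y = refl
  *-^ xx∈Li (suc k) y = trans (distrib _ _ _) (trans (xx∈Li _) (*-^ xx∈Li k y))

  -- Every `t x x k` collapses to `x`, and one of them is in `Li`.
  idempotent⇒Li : x * x ≈ x → x ∈ Li
  idempotent⇒Li {x} e = let k , p = t-reaches-Li x x in Li-resp (t≈x k) p
    where
    t≈x : ∀ k → t x x k ≈ x
    t≈x zero          = refl
    t≈x (suc zero)    = refl
    t≈x (suc (suc k)) = trans (*-cong (t≈x (suc k)) (t≈x k)) e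

  Li⇒≲ : y ∈ Li → x ≲ y
  Li⇒≲ y∈Li = 0 , y∈Li

  ≲-respʳ : y ≈ y′ → x ≲ y → x ≲ y′
  ≲-respʳ e (k , p) = k , Li-resp (^-cong refl e k) p

  ≲-respˡ : x ≈ x′ → x ≲ y → x′ ≲ y
  ≲-respˡ e (k , p) = k , Li-resp (^-cong e refl k) p

  Li-≲ : x ∈ Li → x ≲ y → y ∈ Li
  Li-≲ x∈Li (k , p) = Li-resp (Li-^ x∈Li k _) p

  -- Some t x x k ∈ Li is a term in x, hence maps a right power of x to the
  -- next one; but it fixes it, so this right power is idempotent.
  ≲-refl : x ≲ x
  ≲-refl {x} = n , idempotent⇒Li (begin
    x ^[ n ] x * x ^[ n ] x ≈⟨ sym (^-* x n x x) ⟩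
    x ^[ n ] (x * x)        ≈⟨ sym (^-suc x n x) ⟩
    x ^[ suc n ] x          ≡⟨ ≡.sym (eval-gen^ (suc n)) ⟩
    evalL (gen^ (suc n))    ≈⟨ sym (FreeLD.eval-cong L x (proj₂ (absorbs τ) 0)) ⟩
    evalL τ * evalL (gen^ n) ≡⟨ ≡.cong₂ _*_ (eval-t k) (eval-gen^ n) ⟩
    t x x k * x ^[ n ] x    ≈⟨ tₖ∈Li _ ⟩
    x ^[ n ] x              ∎)
    where
    open Comparison using (gen^; absorbs)
    evalL = FreeLD.eval L x
    τ′ = Permutativity.t FreeLD.free FreeLD.gen FreeLD.gen
    eval-gen^ : ∀ n → evalL (gen^ n) ≡ x ^[ n ] x
    eval-gen^ zero    = ≡.refl
    eval-gen^ (suc n) = ≡.cong (x *_) (eval-gen^ n)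
    eval-t : ∀ k → evalL (τ′ k) ≡ t x x k
    eval-t zero          = ≡.refl
    eval-t (suc zero)    = ≡.refl
    eval-t (suc (suc k)) = ≡.cong₂ _*_ (eval-t (suc k)) (eval-t k)
    k = proj₁ (t-reaches-Li x x)
    tₖ∈Li = proj₂ (t-reaches-Li x x)
    τ = τ′ k
    n = proj₁ (absorbs τ)

  ≈⇒≲ : x ≈ y → x ≲ y
  ≈⇒≲ e = ≲-respʳ e ≲-refl

  -- Applying `x` `k` times turns `y` into an element of `Li`, which erases the `j` applications of
  -- `y` to `z`.
  ≲-trans : x ≲ y → y ≲ z → x ≲ z
  ≲-trans {x} {y} {z} (k , p) (j , q) =
    k , Li-resp (trans (^-^ x k y j z) (Li-^ p j _)) (^-Li k q)

  *-monoʳ-≲ : ∀ x → y ≲ z → x * y ≲ x * z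
  *-monoʳ-≲ x (k , p) = k , Li-resp (^-^ x 1 _ k _) (Li-leftIdeal x p)

  ≲⇒≲* : ∀ w → x ≲ z → x ≲ w * z
  ≲⇒≲* w (k , p) = k , Li-resp (sym (^-* _ k w _)) (Li-leftIdeal _ p)

  ≲* : ∀ x y → y ≲ x * y
  ≲* x y = ≲⇒≲* x ≲-refl

  -- Two consecutive terms of the sequence are comparable once one is in `Li`. Comparability passes
  -- back to the preceding pair because each new term is the product of the previous two.
  ≲-total : ∀ x y → x ≲ y ⊎ y ≲ x
  ≲-total x y = let k , p = t-reaches-Li x y in back k (inj₁ (Li⇒≲ p))
    where
    back : ∀ k → t x y (suc k) ≲ t x y k ⊎ t x y k ≲ t x y (suc k) → x ≲ y ⊎ y ≲ x
    back zero    p        = p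
    back (suc k) (inj₂ (j , p)) =
      back k (inj₁ (suc j , Li-resp (sym (^-suc _ j _)) p))
    back (suc k) (inj₁ p) = back k (inj₂ (≲-trans (≲* _ _) p))

  -- After `d ^[ k ]_` sends `x` into `Li`, acting by `z` and by `d` is the same, so `z ≲ z` becomes
  -- `d ≲ z`.
  *≲⇒≲ : x * z ≲ x → x * z ≲ z
  *≲⇒≲ {x} {z} (k , p) = let j , q = ≲-refl {z} in
    k + j , Li-resp (sym (trans (^-+ d k j z) (sym (absorb j z)))) (^-Li k q)
    where
    d = x * z
    -- d^k * x ∈ Li and x * (z * w) = d * (x * w).
    absorb₁ : ∀ w → d ^[ k ] (z * w) ≈ d ^[ k ] (d * w)
    absorb₁ w = begin
      d ^[ k ] (z * w)                    ≈⟨ sym (p _) ⟩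
      d ^[ k ] x * d ^[ k ] (z * w)       ≈⟨ sym (^-* d k x _) ⟩
      d ^[ k ] (x * (z * w))              ≈⟨ ^-cong refl (distrib x z w) k ⟩
      d ^[ k ] (d * (x * w))              ≈⟨ ^-* d k d _ ⟩
      d ^[ k ] d * d ^[ k ] (x * w)       ≈⟨ *-cong refl (trans (^-* d k x w) (p _)) ⟩
      d ^[ k ] d * d ^[ k ] w             ≈⟨ sym (^-* d k d w) ⟩
      d ^[ k ] (d * w)                    ∎
    absorb : ∀ j w → d ^[ k ] (z ^[ j ] w) ≈ d ^[ k ] (d ^[ j ] w)
    absorb zero    w = refl
    absorb (suc j) w = begin
      d ^[ k ] (z * z ^[ j ] w)   ≈⟨ absorb₁ _ ⟩
      d ^[ k ] (d * z ^[ j ] w)   ≈⟨ sym (^-suc d k _) ⟩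
      d * d ^[ k ] (z ^[ j ] w)   ≈⟨ *-cong refl (absorb j w) ⟩
      d * d ^[ k ] (d ^[ j ] w)   ≈⟨ ^-suc d k _ ⟩
      d ^[ k ] (d * d ^[ j ] w)   ∎

  -- Together with `≲*`: `x^♯` fixes the critical points below crit(x).
  ≴⇒*≲ : ¬ x ≲ z → x * z ≲ z
  ≴⇒*≲ {x} {z} x≴z with ≲-total (x * z) x
  ... | inj₁ p       = *≲⇒≲ p
  ... | inj₂ (k , p) = contradiction (suc k , Li-resp (sym (^-suc x k z)) p) x≴z

  ≴⇒^≲ : ∀ k → ¬ x ≲ z → x ^[ k ] z ≲ z
  ≴⇒^≲ zero    x≴z = ≲-refl
  ≴⇒^≲ (suc k) x≴z = ≲-trans (*-monoʳ-≲ _ (≴⇒^≲ k x≴z)) (≴⇒*≲ x≴z)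

  ≲^ : ∀ x k y → y ≲ x ^[ k ] y
  ≲^ x zero    y = ≲-refl
  ≲^ x (suc k) y = ≲-trans (≲^ x k y) (≲* x _)

  -- `x^♯` strictly raises non-maximal critical points from crit(x) on: otherwise its iterates would
  -- never carry crit(z) to the maximum.
  ≲⇒*≴ : x ≲ z → z ∉ Li → ¬ x * z ≲ z
  ≲⇒*≴ {x} {z} (k , p) z∉Li q = z∉Li (Li-≲ p (^≲ k))
    where
    ^≲ : ∀ k → x ^[ k ] z ≲ z
    ^≲ zero    = ≲-refl
    ^≲ (suc k) = ≲-trans (*-monoʳ-≲ x (^≲ k)) q

  *-∉Li⇒∉Li : x * y ∉ Li → y ∉ Li
  *-∉Li⇒∉Li p q = p (Li-leftIdeal _ q)

  crit-upward : x ≲ y → y ∉ Li → x ∉ Li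
  crit-upward x≲y y∉Li x∈Li = y∉Li (Li-≲ x∈Li x≲y)

  Maximum⇒Li : Maximum _≲_ x → x ∈ Li
  Maximum⇒Li {x} max = let k , p = t-reaches-Li x x in Li-≲ p (max _)

  point∈Li : Carrier → ∃[ e ] e ∈ Li
  point∈Li x = let k , p = t-reaches-Li x x in t x x k , p

  BelowMax⇒∉Li : BelowMax x → x ∉ Li
  BelowMax⇒∉Li (μ , max , x≲μ , x≁μ) x∈Li = x≁μ (x≲μ , Li⇒≲ x∈Li)

  ∉Li⇒BelowMax : x ∉ Li → BelowMax x
  ∉Li⇒BelowMax {x} x∉Li = let e , e∈Li = point∈Li x in
    e , (λ _ → Li⇒≲ e∈Li) , Li⇒≲ e∈Li , λ (_ , e≲x) → x∉Li (Li-≲ e∈Li e≲x)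

  -- Congruences modulo a critical point.

  -- s ⊢ x ≡ y is x ≡^α y for α = crit(s).
  infix 4 _⊢_≡_
  _⊢_≡_ : Carrier → Rel Carrier ℓ
  s ⊢ x ≡ y = ∃[ k ] s ^[ k ] x ≈ s ^[ k ] y

  ⊢-sym : ∀ {s} → s ⊢ x ≡ y → s ⊢ y ≡ x
  ⊢-sym (k , p) = k , sym p

  ^-raiseˡ : ∀ {s} j k → s ^[ k ] x ≈ s ^[ k ] y → s ^[ j + k ] x ≈ s ^[ j + k ] y
  ^-raiseˡ {s = s} j k p =
    trans (^-+ s j k _) (trans (^-cong refl p j) (sym (^-+ s j k _)))

  ^-raiseʳ : ∀ {s} j k → s ^[ j ] x ≈ s ^[ j ] y → s ^[ j + k ] x ≈ s ^[ j + k ] y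
  ^-raiseʳ {s = s} j k p =
    trans (^-+′ s j k _) (trans (^-cong refl p k) (sym (^-+′ s j k _)))

  ⊢-trans : ∀ {s} → s ⊢ x ≡ y → s ⊢ y ≡ z → s ⊢ x ≡ z
  ⊢-trans (j , p) (k , q) = j + k , trans (^-raiseʳ j k p) (^-raiseˡ j k q)

  ⊢-*-cong : ∀ {s} → s ⊢ x ≡ x′ → s ⊢ y ≡ y′ → s ⊢ x * y ≡ x′ * y′
  ⊢-*-cong {s = s} p q = ⊢-trans (congʳ p) (congˡ q)
    where
    congʳ : s ⊢ x ≡ x′ → s ⊢ x * y ≡ x′ * y
    congʳ (k , p) = k , trans (^-* s k _ _) (trans (*-cong p refl) (sym (^-* s k _ _)))
    congˡ : s ⊢ y ≡ y′ → s ⊢ x * y ≡ x * y′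
    congˡ (k , p) = k , trans (^-* s k _ _) (trans (*-cong refl p) (sym (^-* s k _ _)))

  -- Applying `s ^[ k ]_` with `s ^[ k ] r ∈ Li` strips the iterates of `r` from both sides.
  ⊢-anti : ∀ {r s} → s ≲ r → r ⊢ x ≡ y → s ⊢ x ≡ y
  ⊢-anti {x} {y} {r} {s} (k , p) (j , q) = k , (begin
    s ^[ k ] x                         ≈⟨ sym (Li-^ p j _) ⟩
    (s ^[ k ] r) ^[ j ] (s ^[ k ] x)   ≈⟨ sym (^-^ s k r j x) ⟩
    s ^[ k ] (r ^[ j ] x)              ≈⟨ ^-cong refl q k ⟩
    s ^[ k ] (r ^[ j ] y)              ≈⟨ ^-^ s k r j y ⟩
    (s ^[ k ] r) ^[ j ] (s ^[ k ] y)   ≈⟨ Li-^ p j _ ⟩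
    s ^[ k ] y                         ∎)

  ⊢-self : ∀ {s x} y → s ≲ x → s ⊢ x * y ≡ y
  ⊢-self {s} {x} y (k , p) = k , trans (^-* s k x y) (p _)

  ⊢-* : ∀ {s} w → s ⊢ x ≡ y → w * s ⊢ w * x ≡ w * y
  ⊢-* w (k , p) = k , trans (sym (^-^ w 1 _ k _)) (trans (*-cong refl p) (^-^ w 1 _ k _))

  ≲-resp-⊢ : ∀ {s} → s ⊢ x ≡ y → s ≲ x → s ≲ y
  ≲-resp-⊢ {s = s} (k , p) (j , q) = j + k ,
    Li-resp (^-raiseˡ j k p) (Li-resp (sym (^-+′ s j k _)) (^-Li k q))

  -- Below crit(s) the iterates of `s` leave critical points fixed.
  ⊢⇒≲ : ∀ {s} → ¬ s ≲ y → s ⊢ x ≡ y → x ≲ y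
  ⊢⇒≲ {s = s} s≴y (k , p) = ≲-trans (≲-respʳ p (≲^ s k _)) (≴⇒^≲ k s≴y)

  ⊢⇒∼ : ∀ {s} → ¬ s ≲ x → s ⊢ x ≡ y → x ∼ y
  ⊢⇒∼ s≴x p = ⊢⇒≲ (s≴x ∘′ ≲-resp-⊢ (⊢-sym p)) p , ⊢⇒≲ s≴x (⊢-sym p)

  -- `x^♯` fixes what lies below crit(x) and sends everything else to at least crit(x * x), which
  -- exceeds crit(x).
  crit∉range : x ∉ Li → ¬ x ∼ x * z
  crit∉range {x} {z} x∉Li (x≲xz , xz≲x) = x≴z (≲-trans x≲xz (≴⇒*≲ x≴z))
    where
    x≴z : ¬ x ≲ z
    x≴z x≲z = ≲⇒*≴ ≲-refl x∉Li (≲-trans (*-monoʳ-≲ x x≲z) xz≲x)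

  -- Paths of partial products and the absence of cycles.

  data Path {p} (P : Pred Carrier p) : Carrier → Carrier → Set (c ⊔ ℓ ⊔ p) where
    last : a ∈ P → a ≈ b → Path P a b
    step : ∀ y → a ∈ P → Path P (a * y) b → Path P a b

  private variable
    p q : Level
    P Q : Pred Carrier p

  Path-map : (∀ {a} → a ∈ P → a ∈ Q) → Path P a b → Path Q a b
  Path-map f (last a∈P e)   = last (f a∈P) e
  Path-map f (step y a∈P r) = step y (f a∈P) (Path-map f r)

  Path-invariant : (∀ {a b} → a ≈ b → a ∈ Q → b ∈ Q) →
                   (∀ {a} y → a ∈ P → a ∈ Q → a * y ∈ Q) →
                   Path P a b → a ∈ Q → b ∈ Q
  Path-invariant resp next (last _ e)     q = resp e q
  Path-invariant resp next (step y a∈P r) q = Path-invariant resp next r (next y a∈P q)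

  Path-respʳ : b ≈ x → Path P a b → Path P a x
  Path-respʳ e (last a∈P f)   = last a∈P (trans f e)
  Path-respʳ e (step y a∈P r) = step y a∈P (Path-respʳ e r)

  Path-last : (∀ {a b} → a ≈ b → a ∈ P → b ∈ P) → Path P a b → b ∈ P
  Path-last resp (last a∈P e) = resp e a∈P
  Path-last resp (step _ _ r) = Path-last resp r

  -- Critical points are linearly ordered, so a finite path has a node with the largest one. The
  -- path is also split there, to let the cycle be entered at that node.
  maxNode : Path (_∉ Li) a b →
            ∃[ m ] m ∉ Li × Path (_≲ m) a b × Path (_≲ m) a m × Path (_≲ m) m b
  maxNode {a} (last a∉Li e) = a , a∉Li , last ≲-refl e , last ≲-refl refl , last ≲-refl e
  maxNode {a} (step y a∉Li r) with maxNode r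
  ... | m , m∉Li , r₀ , r₁ , r₂ with ≲-total a m
  ...   | inj₁ a≲m = m , m∉Li , step y a≲m r₀ , step y a≲m r₁ , r₂
  ...   | inj₂ m≲a = a , a∉Li , r′ , last ≲-refl refl , r′
    where
    r′ = step y ≲-refl (Path-map (λ x≲m → ≲-trans x≲m m≲a) r₀)

  -- Start from a node m of maximal critical point.  All nodes u after m
  -- satisfy u ≡ m * z modulo some critical point above crit(m), so on the
  -- return to m, crit(m) would be in the range of m^♯.
  no-cycle : ∀ y → ¬ Path (_∉ Li) (a * y) a
  no-cycle {a} y r = returns (Path-invariant D-resp (λ y u≲m d → D-next y u≲m (inj₂ d)) r₁
    (D-next y (Path-last (≲-respˡ) r₂)
      (Path-invariant J-resp (λ y u≲m j → inj₂ (D-next y u≲m j)) r₂ (inj₁ refl))))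
    where
    max  = maxNode r
    m    = proj₁ max
    m∉Li = proj₁ (proj₂ max)
    r₁   = proj₁ (proj₂ (proj₂ (proj₂ max)))
    r₂   = proj₂ (proj₂ (proj₂ (proj₂ max)))

    -- The cycle is run from `m` to `a` to `a * y` and back to `m`. `J` holds on the first stretch,
    -- where `m` itself need not satisfy `D`; the step by `y` enters `D`, which then persists.
    D J : Pred Carrier _
    D u = ∃₂ λ s z → ¬ s ≲ m × s ⊢ u ≡ m * z
    J u = u ≈ m ⊎ D u

    D-resp : ∀ {u v} → u ≈ v → u ∈ D → v ∈ D
    D-resp e (s , z , s≴m , k , p) = s , z , s≴m , k , trans (^-cong refl (sym e) k) p

    J-resp : ∀ {u v} → u ≈ v → u ∈ J → v ∈ J
    J-resp e (inj₁ f) = inj₁ (trans (sym e) f)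
    J-resp e (inj₂ d) = inj₂ (D-resp e d)

    D-next : ∀ {u} y → u ≲ m → u ∈ J → u * y ∈ D
    D-next y u≲m (inj₁ e) = let o , o∈Li = point∈Li m in
      o , y , (λ o≲m → m∉Li (Li-≲ o∈Li o≲m)) , 0 , *-cong e refl
    -- `u * y` is `u * (m * y)` modulo `u * m`, and this is `(m * z) * (m * y) = m * (z * y)` modulo
    -- `s`. The smaller modulus serves; `u * m` lies above `m` because `u ≲ m`.
    D-next {u} y u≲m (inj₂ (s , z , s≴m , p)) = [ below-s , below-um ]′ (≲-total s (u * m))
      where
      modulo : ∀ r → r ≲ s → r ≲ u * m → r ⊢ u * y ≡ m * (z * y)
      modulo r r≲s r≲um = ⊢-trans
        (⊢-anti r≲um (⊢-sym (⊢-* u (⊢-self y ≲-refl))))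
        (⊢-trans (⊢-anti r≲s (⊢-*-cong p (0 , refl))) (0 , sym (distrib m z y)))
      below-s  = λ s≲um → s , z * y , s≴m , modulo s ≲-refl s≲um
      below-um = λ um≲s → u * m , z * y , ≲⇒*≴ u≲m m∉Li , modulo (u * m) um≲s ≲-refl

    returns : m ∉ D
    returns (s , z , s≴m , p) = crit∉range m∉Li (⊢⇒∼ s≴m p)

-- Composition as a term in `*`.

module CompositionTheory {c ℓ} (L : LDSystem c ℓ) (_∘_ : Op₂ (LDSystem.Carrier L))
                         (1# : LDSystem.Carrier L)
                         (isComposition : Permutativity.IsComposition L _∘_ 1#) where
  open LDSystem L
  open Permutativity L
  open Permutativity.IsComposition isComposition

  ∘-t : ∀ x y k → (x ∘ y) ≈ (t x y (suc k) ∘ t x y k)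
  ∘-t x y zero    = refl
  ∘-t x y (suc k) = trans (∘-t x y k) (∘-twist _ _)

  ∘≈t : ∀ x y k → t x y k ≈ 1# → (x ∘ y) ≈ t x y (suc k)
  ∘≈t x y k e = trans (∘-t x y k) (trans (∘-cong refl e) (∘-identityʳ _))

  -- Distributivity moves the action along the sequence just as the twist moves `∘`; where the
  -- sequence meets `Li`, this yields the action law.
  t-action : ∀ x y k z → x * (y * z) ≈ t x y (suc k) * (t x y k * z)
  t-action x y zero    z = refl
  t-action x y (suc k) z = trans (t-action x y k z) (distrib _ _ z)

-- Vast inverse systems

module VastTheory {c ℓ} (em : ExcludedMiddle (c ⊔ ℓ))
                  (𝒳 : InverseSystem c ℓ) (vast : IsVast 𝒳) where
  open Limit 𝒳 vast
  open IsVast vast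
  open Permutativity using (Li)

  module L {n} = LDSystem (X n)
  module P {n} = PermutativeTheory (X n) (isPermutative n)
  module φ {n} = IsMagmaHomomorphism (φ-isHomomorphism n)
  open L using (_*_; _≈_)
  open P using (_^[_]_; _⊢_≡_; Li-resp; ≲-refl; ≲-trans; ≈⇒≲; Li⇒≲; Li-≲)

  infix 4 _≲_ _∼_

  NonLi : ∀ {n} → Pred (X.Carrier n) (c ⊔ ℓ)
  NonLi {n} x = x ∉ Li (X n)

  _≲_ _∼_ : ∀ {n} → Rel (X.Carrier n) (c ⊔ ℓ)
  _≲_ {n} = Permutativity._≲_ (X n)
  _∼_ {n} = Permutativity._∼_ (X n)

  point : ∀ n → X.Carrier n
  point n = φ n (α n)

  ⊤ : ∀ n → X.Carrier n
  ⊤ n = proj₁ (P.point∈Li (point n))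

  ⊤∈Li : ∀ {n} → ⊤ n ∈ Li (X n)
  ⊤∈Li {n} = proj₂ (P.point∈Li (point n))

  φ*-suc : ∀ k n x → ∃[ y ] φ* (suc k) n x ≡ φ n y
  φ*-suc zero    n x = x , ≡.refl
  φ*-suc (suc k) n x = φ*-suc k n (φ (suc k + n) x)

  -- Level `n` itself is impossible: `Li` is a left ideal, so the product would be in `Li`.
  extension : ∀ n (x y : X.Carrier n) → y ∈ Li (X n) →
              ∃[ k ] ∃₂ λ x′ y′ → φ* (suc k) n x′ ≈ x × φ* (suc k) n y′ ≈ y × NonLi (x′ * y′)
  extension n x y y∈Li with nonLi n x y
  ... | zero  , x′ , y′ , _ , e , p =
    contradiction (P.Li-leftIdeal x′ (Li-resp (L.sym e) y∈Li)) p
  ... | suc k , r = k , r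

  -- A lift exists at some level above `n`; its image at level `suc n` is a preimage.
  φ-surjective : ∀ {n} (x : X.Carrier n) → ∃[ y ] φ n y ≈ x
  φ-surjective {n} x =
    let k , x′ , _ , e , _ = extension n x (⊤ n) ⊤∈Li
        y , f = φ*-suc k n x′
    in y , L.trans (L.reflexive (≡.sym f)) e

  φ-Li : ∀ {n} {x : X.Carrier (suc n)} → x ∈ Li (X (suc n)) → φ n x ∈ Li (X n)
  φ-Li x∈Li y = let y′ , e = φ-surjective y in
    L.trans (L.*-cong L.refl (L.sym e))
      (L.trans (L.sym (φ.homo _ y′)) (L.trans (φ.⟦⟧-cong (x∈Li y′)) e))

  φ-^ : ∀ {n} (x y : X.Carrier (suc n)) k → φ n (x ^[ k ] y) ≈ φ n x ^[ k ] φ n y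
  φ-^ x y zero    = L.refl
  φ-^ x y (suc k) = L.trans (φ.homo x _) (L.*-cong L.refl (φ-^ x y k))

  φ-≲ : ∀ {n} {x y : X.Carrier (suc n)} → x ≲ y → φ n x ≲ φ n y
  φ-≲ (k , p) = k , Li-resp (φ-^ _ _ k) (φ-Li p)

  φ≈⇒⊢ : ∀ {n} {x y : X.Carrier (suc n)} → φ n x ≈ φ n y → α n ⊢ x ≡ y
  φ≈⇒⊢ {n} {x} {y} e = let r , (_ , α≲r) , _ , p = to (kernel n x y) e in
    P.⊢-anti α≲r (1 , p)

  ⊢⇒φ≈ : ∀ {n} {x y : X.Carrier (suc n)} → α n ⊢ x ≡ y → φ n x ≈ φ n y
  ⊢⇒φ≈ {n} {x} {y} p =
    -- The trivial instance of the kernel condition supplies an `r` for which iterates collapse to a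
    -- single application.
    let r , r∼α@(r≲α , _) , rr∈Li , _ = to (kernel n x x) L.refl
        k , q = P.⊢-anti r≲α p
    in from (kernel n x y)
         (r , r∼α , rr∈Li , L.trans (L.sym (P.*-^ rr∈Li k x))
                              (L.trans (L.*-cong L.refl q) (P.*-^ rr∈Li k y)))

  α≲⇒φ∈Li : ∀ {n} {x : X.Carrier (suc n)} → α n ≲ x → φ n x ∈ Li (X n)
  α≲⇒φ∈Li α≲x y = let y′ , e = φ-surjective y in
    L.trans (L.*-cong L.refl (L.sym e))
      (L.trans (L.sym (φ.homo _ y′)) (L.trans (⊢⇒φ≈ (P.⊢-self y′ α≲x)) e))

  -- `x * x` and `x` have the same image, so some iterate of `α n` makes `x` idempotent.
  φ∈Li⇒α≲ : ∀ {n} {x : X.Carrier (suc n)} → φ n x ∈ Li (X n) → α n ≲ x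
  φ∈Li⇒α≲ {x = x} φx∈Li =
    let k , p = φ≈⇒⊢ (L.trans (φ.homo x x) (φx∈Li _)) in
    k , P.idempotent⇒Li (L.trans (L.sym (P.^-* _ k x x)) p)

  φ-≲-reflect : ∀ {n} {x y : X.Carrier (suc n)} → φ n x ≲ φ n y → x ≲ y ⊎ α n ≲ y
  φ-≲-reflect {x = x} {y} (k , p) with em {P = x ≲ y}
  ... | yes x≲y = inj₁ x≲y
  ... | no  x≴y = inj₂ (≲-trans (φ∈Li⇒α≲ (Li-resp (L.sym (φ-^ x y k)) p)) (P.≴⇒^≲ k x≴y))

  -- The directed system of critical points.

  -- up n represents the inclusion of crit[X_n] in crit[X_{n+1}].
  up : ∀ n → X.Carrier n → X.Carrier (suc n)
  up n a with em {P = a ∈ Li (X n)}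
  ... | yes _ = α n
  ... | no  _ = proj₁ (φ-surjective a)

  up-spec : ∀ {n} (a : X.Carrier n) →
            (a ∈ Li (X n) × up n a ≡ α n) ⊎ (NonLi a × φ n (up n a) ≈ a)
  up-spec {n} a with em {P = a ∈ Li (X n)}
  ... | yes a∈Li = inj₁ (a∈Li , ≡.refl)
  ... | no  a∉Li = inj₂ (a∉Li , proj₂ (φ-surjective a))

  φ-up : ∀ {n} (a : X.Carrier n) → φ n (up n a) ∼ a
  φ-up a with up-spec a
  ... | inj₁ (a∈Li , e) = Li⇒≲ a∈Li , Li⇒≲ (α≲⇒φ∈Li (≈⇒≲ (L.reflexive (≡.sym e))))
  ... | inj₂ (_ , e)    = ≈⇒≲ e , ≈⇒≲ (L.sym e)

  up≲α : ∀ {n} (a : X.Carrier n) → up n a ≲ α n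
  up≲α {n} a with up-spec a
  ... | inj₁ (_ , e)    = ≈⇒≲ (L.reflexive e)
  ... | inj₂ (a∉Li , e) with P.≲-total (up n a) (α n)
  ...   | inj₁ p = p
  ...   | inj₂ p = contradiction (Li-resp e (α≲⇒φ∈Li p)) a∉Li

  ≲φ⇒up≲ : ∀ {n} {b : X.Carrier n} {y} → b ≲ φ n y → up n b ≲ y
  ≲φ⇒up≲ {b = b} p with φ-≲-reflect (≲-trans (proj₁ (φ-up b)) p)
  ... | inj₁ q = q
  ... | inj₂ q = ≲-trans (up≲α b) q

  φ≲⇒≲up : ∀ {n} {b : X.Carrier n} {y} → NonLi b → φ n y ≲ b → y ≲ up n b
  φ≲⇒≲up {b = b} b∉Li p with φ-≲-reflect (≲-trans p (proj₂ (φ-up b)))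
  ... | inj₁ q = q
  ... | inj₂ q = contradiction (Li-≲ (α≲⇒φ∈Li q) (proj₁ (φ-up b))) b∉Li

  up-mono : ∀ {n} {a b : X.Carrier n} → a ≲ b → up n a ≲ up n b
  up-mono {b = b} p = ≲φ⇒up≲ (≲-trans p (proj₂ (φ-up b)))

  up-NonLi : ∀ {n} {a : X.Carrier n} → NonLi a → NonLi (up n a)
  up-NonLi {a = a} a∉Li p = a∉Li (Li-≲ (φ-Li p) (proj₁ (φ-up a)))

  -- at N (n , a) represents the image of crit(a) in crit[X_N]; its value is
  -- junk unless n ≤ N.
  at : ∀ N → Crit → X.Carrier N
  at zero    (n , a) with n ≟ zero
  ... | yes ≡.refl = a
  ... | no  _      = point zero
  at (suc N) (n , a) with n ≟ suc N
  ... | yes ≡.refl = a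
  ... | no  _      = up N (at N (n , a))

  at-self : ∀ {n} (a : X.Carrier n) → at n (n , a) ≡ a
  at-self {zero}  a = ≡.refl
  at-self {suc n} a with suc n ≟ suc n
  ... | yes ≡.refl = ≡.refl
  ... | no  n≢n    = contradiction ≡.refl n≢n

  at-suc : ∀ {n N} (a : X.Carrier n) → n ≤ N → at (suc N) (n , a) ≡ up N (at N (n , a))
  at-suc {n} {N} a n≤N with n ≟ suc N
  ... | yes ≡.refl = contradiction n≤N ℕ.1+n≰n
  ... | no  _      = ≡.refl

  module _ {p} (Q : ℕ → Set p) where
    ≤-induction : ∀ {m} → Q m → (∀ {n} → m ≤ n → Q n → Q (suc n)) → ∀ {n} → m ≤ n → Q n
    ≤-induction {m} base next m≤n = go (ℕ.≤⇒≤′ m≤n)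
      where
      go : ∀ {n} → m ≤′ n → Q n
      go (ℕ.≤′-reflexive ≡.refl) = base
      go (≤′-step m≤′n) = next (ℕ.≤′⇒≤ m≤′n) (go m≤′n)

  level : Crit → ℕ
  level = proj₁

  ≡⇒≲ : ∀ {n} {a b : X.Carrier n} → a ≡ b → a ≲ b
  ≡⇒≲ e = ≈⇒≲ (L.reflexive e)

  at-mono : ∀ p q {N M} → level p ≤ N → level q ≤ N → N ≤ M →
            at N p ≲ at N q → at M p ≲ at M q
  at-mono (_ , a) (_ , b) n≤N m≤N N≤M r = ≤-induction (λ M → at M _ ≲ at M _) r
    (λ N≤M r → ≲-trans (≡⇒≲ (at-suc a (ℕ.≤-trans n≤N N≤M)))
      (≲-trans (up-mono r) (≡⇒≲ (≡.sym (at-suc b (ℕ.≤-trans m≤N N≤M)))))) N≤M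

  at-NonLi : ∀ {n N} {a : X.Carrier n} → n ≤ N → NonLi a → NonLi (at N (n , a))
  at-NonLi {a = a} n≤N a∉Li = ≤-induction (λ N → NonLi (at N (_ , a)))
    (≡.subst NonLi (≡.sym (at-self a)) a∉Li)
    (λ n≤N r → ≡.subst NonLi (≡.sym (at-suc a n≤N)) (up-NonLi r)) n≤N

  Identified-sound : ∀ {p q} → Identified p q → ∃[ M ] ∀ N → M ≤ N → at N p ∼ at N q
  Identified-sound {n , a} {_ , b} (same (p , q)) = n , λ N n≤N →
    at-mono (n , a) (n , b) ℕ.≤-refl ℕ.≤-refl n≤N (selves p) ,
    at-mono (n , b) (n , a) ℕ.≤-refl ℕ.≤-refl n≤N (selves q)
    where
    selves : ∀ {a b : X.Carrier n} → a ≲ b → at n (n , a) ≲ at n (n , b)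
    selves {a} {b} p = ≲-trans (≡⇒≲ (at-self a)) (≲-trans p (≡⇒≲ (≡.sym (at-self b))))
  Identified-sound (lift {n} x φx∉Li) = suc n , λ N n<N →
    at-mono (n , φ n x) (suc n , x) (ℕ.n≤1+n n) ℕ.≤-refl n<N
      (≲-trans (≡⇒≲ e) (≲-trans (≲φ⇒up≲ ≲-refl) (≡⇒≲ (≡.sym (at-self x))))) ,
    at-mono (suc n , x) (n , φ n x) ℕ.≤-refl (ℕ.n≤1+n n) n<N
      (≲-trans (≡⇒≲ (at-self x)) (≲-trans (φ≲⇒≲up φx∉Li ≲-refl) (≡⇒≲ (≡.sym e))))
    where
    e : at (suc n) (n , φ n x) ≡ up n (φ n x)
    e = ≡.trans (at-suc (φ n x) ℕ.≤-refl) (≡.cong (up n) (at-self (φ n x)))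
  Identified-sound (top {n} {a} max) = suc n , λ N n<N →
    at-mono (n , a) (suc n , α n) (ℕ.n≤1+n n) ℕ.≤-refl n<N (≡⇒≲ e) ,
    at-mono (suc n , α n) (n , a) ℕ.≤-refl (ℕ.n≤1+n n) n<N (≡⇒≲ (≡.sym e))
    where
    up≡α : up n a ≡ α n
    up≡α with up-spec a
    ... | inj₁ (_ , e)    = e
    ... | inj₂ (a∉Li , _) = contradiction (P.Maximum⇒Li max) a∉Li
    e : at (suc n) (n , a) ≡ at (suc n) (suc n , α n)
    e = ≡.trans (≡.trans (at-suc a ℕ.≤-refl) (≡.cong (up n) (at-self a)))
                (≡.trans up≡α (≡.sym (at-self (α n))))

  -- The zigzag may climb above both ends, so the comparison is made only beyond all its levels.
  ≈crit-sound : ∀ {p q} → p ≈crit q → ∃[ M ] ∀ N → M ≤ N → at N p ∼ at N q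
  ≈crit-sound ε = 0 , λ _ _ → ≲-refl , ≲-refl
  ≈crit-sound (fwd r ◅ rs) =
    let M , s = Identified-sound r
        K , s′ = ≈crit-sound rs
    in M + K , λ N M+K≤N →
      let p , q = s N (ℕ.m+n≤o⇒m≤o M M+K≤N)
          p′ , q′ = s′ N (ℕ.m+n≤o⇒n≤o M M+K≤N)
      in ≲-trans p p′ , ≲-trans q′ q
  ≈crit-sound (bwd r ◅ rs) =
    let M , s = Identified-sound r
        K , s′ = ≈crit-sound rs
    in M + K , λ N M+K≤N →
      let p , q = s N (ℕ.m+n≤o⇒m≤o M M+K≤N)
          p′ , q′ = s′ N (ℕ.m+n≤o⇒n≤o M M+K≤N)
      in ≲-trans q p′ , ≲-trans q′ p

  ≈crit-up : ∀ {n} (a : X.Carrier n) → (n , a) ≈crit (suc n , up n a)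
  ≈crit-up a with up-spec a
  ... | inj₁ (a∈Li , e) rewrite e = fwd (top (λ _ → Li⇒≲ a∈Li)) ◅ ε
  ... | inj₂ (a∉Li , e) =
    fwd (same (≈⇒≲ (L.sym e) , ≈⇒≲ e)) ◅ fwd (lift _ (a∉Li ∘′ Li-resp e)) ◅ ε

  ≈crit-at : ∀ {n} (a : X.Carrier n) {N} → n ≤ N → (n , a) ≈crit (N , at N (n , a))
  ≈crit-at {n} a = ≤-induction (λ N → (n , a) ≈crit (N , at N (n , a)))
    (≡.subst (λ b → (n , a) ≈crit (n , b)) (≡.sym (at-self a)) ε)
    (λ {N} n≤N r → r ◅◅ ≡.subst (λ b → (N , at N (n , a)) ≈crit (suc N , b))
                          (≡.sym (at-suc a n≤N)) (≈crit-up _))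

  -- Membership in `EE` and closure under `*`.

  EE′ : Pred Seq (c ⊔ ℓ)
  EE′ x = ∀ p → ∃[ N ] level p ≤ N × NonLi (x N * at N p)

  -- `φ` maps `x (suc N) * up N b` to a representative of crit(x N * b). Hence witnessing levels may
  -- be raised freely.
  Lim-up : ∀ {x} → x ∈ Lim → ∀ {N b} → NonLi (x N * b) → NonLi (x (suc N) * up N b)
  Lim-up {x} (lift x∈Lim) {N} {b} p q = p (Li-≲ (φ-Li q) (≲-trans
    (≈⇒≲ (L.trans (φ.homo _ _) (L.*-cong (x∈Lim N) L.refl)))
    (P.*-monoʳ-≲ (x N) (proj₁ (φ-up b)))))

  Lim-at : ∀ {x} → x ∈ Lim → ∀ p {N M} → level p ≤ N → N ≤ M →
           NonLi (x N * at N p) → NonLi (x M * at M p)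
  Lim-at {x} x∈Lim (n , a) n≤N N≤M r = ≤-induction (λ M → NonLi (x M * at M (n , a))) r
    (λ {M} N≤M r → ≡.subst (λ b → NonLi (x (suc M) * b))
                     (≡.sym (at-suc a (ℕ.≤-trans n≤N N≤M))) (Lim-up x∈Lim r)) N≤M

  Lim-NonLi : ∀ {x} → x ∈ Lim → ∀ {n N} → n ≤ N → NonLi (x n) → NonLi (x N)
  Lim-NonLi {x} (lift x∈Lim) n≤N p =
    ≤-induction (λ N → NonLi (x N)) p (λ _ r q → r (Li-resp (x∈Lim _) (φ-Li q))) n≤N

  NonLi-≲ : ∀ {n} {x a b : X.Carrier n} → a ≲ b → NonLi (x * b) → NonLi (x * a)
  NonLi-≲ {x = x} p = P.crit-upward (P.*-monoʳ-≲ x p)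

  EE⇒EE′ : ∀ {x} → x ∈ EE → x ∈ EE′
  EE⇒EE′ {x} (x∈Lim , f) p =
    let m , r , e , below = f p
        K , sound = ≈crit-sound e
        -- Above the witness, the level of `p` and the soundness bound.
        N = m + (level p + K)
        m≤N = ℕ.m≤m+n m (level p + K)
    in N , ℕ.≤-trans (ℕ.m≤m+n (level p) K) (ℕ.m≤n+m _ m) ,
       NonLi-≲ (proj₁ (sound N (ℕ.≤-trans (ℕ.m≤n+m K (level p)) (ℕ.m≤n+m _ m))))
         (Lim-at x∈Lim (m , r) ℕ.≤-refl m≤N
           (≡.subst (λ b → NonLi (x m * b)) (≡.sym (at-self r)) (P.BelowMax⇒∉Li below)))

  EE′⇒EE : ∀ {x} → x ∈ Lim → x ∈ EE′ → x ∈ EE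
  EE′⇒EE x∈Lim f = x∈Lim , λ p@(n , a) →
    let N , n≤N , q = f p in N , at N p , ≈crit-at a n≤N , P.∉Li⇒BelowMax q

  -- A thread of critical points can only drop below the image of the one it
  -- starts at.
  thread≲at : ∀ (z : Seq) {n} b → NonLi b → z n ≲ b →
              (∀ {N} → n ≤ N → φ N (z (suc N)) ≲ z N) →
              ∀ {N} → n ≤ N → z N ≲ at N (n , b)
  thread≲at z b b∉Li base next = ≤-induction (λ N → z N ≲ at N (_ , b))
    (≲-trans base (≡⇒≲ (≡.sym (at-self b))))
    (λ n≤N r → ≲-trans (φ≲⇒≲up (at-NonLi n≤N b∉Li) (≲-trans (next n≤N) r))
                       (≡⇒≲ (≡.sym (at-suc b n≤N))))

  -- First `y` moves `p` to a non-maximal point `b`, then `x` is applied to `b`; at later levels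
  -- crit(y N * at N p) stays below the image of `b`.
  EE-twice : ∀ {x y} → x ∈ EE → y ∈ EE → ∀ p → ∃[ N ] level p ≤ N × NonLi (x N * (y N * at N p))
  EE-twice {x} {y} x∈EE y∈EE@(lift y∈Lim , _) p@(n , a) =
    let M , n≤M , q = EE⇒EE′ y∈EE p
        b = y M * at M p
        N , M≤N , r = EE⇒EE′ x∈EE (M , b)
    in N , ℕ.≤-trans n≤M M≤N , NonLi-≲
         (thread≲at (λ N → y N * at N p) b q ≲-refl
           (λ {K} M≤K → ≲-trans
             (≈⇒≲ (L.trans (φ.homo _ _) (L.*-cong (y∈Lim K) L.refl)))
             (P.*-monoʳ-≲ (y K)
               (≲-trans (φ-≲ (≡⇒≲ (at-suc a (ℕ.≤-trans n≤M M≤K)))) (proj₁ (φ-up (at K p))))))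
           M≤N)
         r

  *-closed-EE : ClosedUnder (pointwise X._*_) EE
  *-closed-EE {x} {y} x∈EE@(lift x∈Lim , _) y∈EE@(lift y∈Lim , _) = EE′⇒EE
    (lift λ n → L.trans (φ.homo _ _) (L.*-cong (x∈Lim n) (y∈Lim n)))
    λ p → let N , n≤N , q = EE-twice x∈EE y∈EE p in
      -- `(x * y) * (x * p) = x * (y * p)` is outside `Li`, and `p ≲ x * p`.
      N , n≤N , NonLi-≲ (P.≲* (x N) _) (q ∘′ Li-resp (L.sym (L.distrib _ _ _)))

  *-closed-EE⁺ : ClosedUnder (pointwise X._*_) EE⁺
  *-closed-EE⁺ {x} {y} (x∈EE , _) (y∈EE@(lift y∈Lim , _) , n , yₙ∉Li) =
    let N , n≤N , q = EE⇒EE′ x∈EE (n , y n) in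
    *-closed-EE x∈EE y∈EE , N ,
      NonLi-≲ (thread≲at y (y n) yₙ∉Li ≲-refl (λ {K} _ → ≈⇒≲ (y∈Lim K)) n≤N) q

  -- Density and the topology

  at≲⊤ : ∀ {n} (a : X.Carrier n) {N} → n ≤ N → at N (n , a) ≲ at N (n , ⊤ n)
  at≲⊤ {n} a {N} n≤N = at-mono (n , a) (n , ⊤ n) ℕ.≤-refl ℕ.≤-refl n≤N
    (≲-trans (Li⇒≲ ⊤∈Li) (≡⇒≲ (≡.sym (at-self (⊤ n)))))

  at≲ : ∀ k n {b : X.Carrier n} {y} → b ≲ φ* k n y → at (k + n) (n , b) ≲ y
  at≲ zero    n {b} p = ≲-trans (≡⇒≲ (at-self b)) p
  at≲ (suc k) n {b} p =
    ≲-trans (≡⇒≲ (at-suc b (ℕ.m≤n+m n k))) (≲φ⇒up≲ (at≲ k n p))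

  extend : ∀ n (x : X.Carrier n) → ∃₂ λ k x′ →
           φ* (suc k) n x′ ≈ x × NonLi (x′ * at (suc k + n) (n , ⊤ n))
  extend n x =
    let k , x′ , y′ , e , f , q = extension n x (⊤ n) ⊤∈Li
    in k , x′ , e , NonLi-≲ (at≲ (suc k) n (≈⇒≲ (L.sym f))) q

  -- down i N x is the image of x in X_i; it is junk unless i ≤ N.
  down : ∀ i N → X.Carrier N → X.Carrier i
  down i zero    x with zero ≟ i
  ... | yes ≡.refl = x
  ... | no  _      = point i
  down i (suc N) x with suc N ≟ i
  ... | yes ≡.refl = x
  ... | no  _      = down i N (φ N x)

  down-self : ∀ n x → down n n x ≡ x
  down-self zero    x = ≡.refl
  down-self (suc n) x with suc n ≟ suc n
  ... | yes ≡.refl = ≡.refl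
  ... | no  n≢n    = contradiction ≡.refl n≢n

  down-suc : ∀ {i N} x → i ≤ N → down i (suc N) x ≡ down i N (φ N x)
  down-suc {i} {N} x i≤N with suc N ≟ i
  ... | yes ≡.refl = contradiction i≤N ℕ.1+n≰n
  ... | no  _      = ≡.refl

  down-cong : ∀ {i N x y} → i ≤ N → x ≈ y → down i N x ≈ down i N y
  down-cong {i} i≤N = ≤-induction (λ N → ∀ {x y} → x ≈ y → down i N x ≈ down i N y)
    (λ {x} {y} e → L.trans (L.reflexive (down-self i x))
                           (L.trans e (L.reflexive (≡.sym (down-self i y)))))
    (λ i≤N f {x} {y} e → L.trans (L.reflexive (down-suc x i≤N))
      (L.trans (f (φ.⟦⟧-cong e)) (L.reflexive (≡.sym (down-suc y i≤N))))) i≤N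

  φ-down : ∀ {i N} x → i < N → φ i (down (suc i) N x) ≡ down i N x
  φ-down {i} x i<N = ≤-induction (λ N → ∀ x → φ i (down (suc i) N x) ≡ down i N x)
    (λ x → ≡.trans (≡.cong (φ i) (down-self (suc i) x))
      (≡.sym (≡.trans (down-suc x ℕ.≤-refl) (down-self i (φ i x)))))
    (λ {n} i<n f x → ≡.trans (≡.cong (φ i) (down-suc x i<n))
      (≡.trans (f (φ n x)) (≡.sym (down-suc x (ℕ.<⇒≤ i<n))))) i<N x

  down-φ* : ∀ {i n} k x → i ≤ n → down i (k + n) x ≡ down i n (φ* k n x)
  down-φ*         zero    x i≤n = ≡.refl
  down-φ* {n = n} (suc k) x i≤n =
    ≡.trans (down-suc x (ℕ.≤-trans i≤n (ℕ.m≤n+m n k))) (down-φ* k (φ (k + n) x) i≤n)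

  Lim-down : ∀ {x} → x ∈ Lim → ∀ {i N} → i ≤ N → down i N (x N) ≈ x i
  Lim-down {x} (lift x∈Lim) {i} = ≤-induction (λ N → down i N (x N) ≈ x i)
    (L.reflexive (down-self i (x i)))
    (λ {n} i≤n e → L.trans (L.reflexive (down-suc (x (suc n)) i≤n))
                     (L.trans (down-cong i≤n (x∈Lim n)) e))

  -- The thread through z that extends, again and again, the current element
  -- so that it keeps the top critical point of the current level below the
  -- maximum.
  module Thread (n : ℕ) (z : X.Carrier n) where

    next : Crit → Crit
    next (N , x) = let k , x′ , _ = extend N x in suc k + N , x′

    stage : ℕ → Crit
    stage = fold (n , z) next

    lev : ℕ → ℕ
    lev j = proj₁ (stage j)

    val : ∀ j → X.Carrier (lev j)
    val j = proj₂ (stage j)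

    lev-step : ∀ j → lev j < lev (suc j)
    lev-step j = s≤s (ℕ.m≤n+m (lev j) (proj₁ (extend (lev j) (val j))))

    lev-mono : ∀ {i j} → i ≤ j → lev i ≤ lev j
    lev-mono {i} = ≤-induction (λ j → lev i ≤ lev j) ℕ.≤-refl
      (λ {j} _ p → ℕ.≤-trans p (ℕ.<⇒≤ (lev-step j)))

    j≤lev : ∀ j → j ≤ lev j
    j≤lev zero    = z≤n
    j≤lev (suc j) = ℕ.≤-<-trans (j≤lev j) (lev-step j)

    down-stage : ∀ {i j k} → i ≤ lev j → j ≤ k → down i (lev k) (val k) ≈ down i (lev j) (val j)
    down-stage {i} {j} i≤ = ≤-induction (λ k → down i (lev k) (val k) ≈ down i (lev j) (val j))
      L.refl
      (λ {k} j≤k e →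
        let k′ , x′ , f , _ = extend (lev k) (val k)
            i≤′ = ℕ.≤-trans i≤ (lev-mono j≤k)
        in L.trans (L.trans (L.reflexive (down-φ* (suc k′) x′ i≤′)) (down-cong i≤′ f)) e)

    -- Stage `i` has level at least `i`, and later stages have the same image there.
    thread : Seq
    thread i = down i (lev i) (val i)

    thread∈Lim : thread ∈ Lim
    thread∈Lim = lift λ i → L.trans (L.reflexive (φ-down (val (suc i)) (j≤lev (suc i))))
      (down-stage (j≤lev i) (ℕ.n≤1+n i))

    thread-lev : ∀ j → thread (lev j) ≈ val j
    thread-lev j = L.trans (down-stage ℕ.≤-refl (j≤lev j)) (L.reflexive (down-self (lev j) (val j)))

    thread-down : ∀ {i} → i ≤ n → thread i ≈ down i n z
    thread-down {i} i≤n = down-stage {k = i} i≤n z≤n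

    thread∈EE : thread ∈ EE
    thread∈EE = EE′⇒EE thread∈Lim λ p@(m , a) →
      -- Stage `m` is already at or above level `m`, so `p` is bounded by the top point of that
      -- stage, which the next stage keeps below the maximum.
      let M = lev m
          N = lev (suc m)
          m≤N = ℕ.≤-trans (ℕ.n≤1+n m) (j≤lev (suc m))
          M≤N = ℕ.<⇒≤ (lev-step m)
          _ , _ , _ , q = extend M (val m)
      in N , m≤N , NonLi-≲
           (at-mono p (M , ⊤ M) (j≤lev m) ℕ.≤-refl M≤N
             (≲-trans (Li⇒≲ ⊤∈Li) (≡⇒≲ (≡.sym (at-self (⊤ M))))))
           (q ∘′ Li-resp (L.*-cong (thread-lev (suc m)) L.refl))

  EE⁺-approximates : ∀ {x} → x ∈ Lim → ∀ n → ∃[ y ] y ∈ EE⁺ × (∀ i → i < n → y i ≈ x i)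
  EE⁺-approximates {x} x∈Lim n =
    -- Only the lift `y′` of `x n` is kept: as a right factor of a product outside `Li`, it is
    -- outside `Li`.
    let k , x′ , y′ , _ , e , q = nonLi n (⊤ n) (x n)
        open Thread (k + n) y′
    in thread ,
       (thread∈EE , k + n , P.*-∉Li⇒∉Li q ∘′ Li-resp (thread-lev 0)) ,
       λ i i<n → let i≤n = ℕ.<⇒≤ i<n in
         L.trans (thread-down (ℕ.≤-trans i≤n (ℕ.m≤n+m n k)))
           (L.trans (L.reflexive (down-φ* k y′ i≤n))
             (L.trans (down-cong i≤n e) (Lim-down x∈Lim i≤n)))

  EE-dense : DenseIn Lim EE
  EE-dense U (W , W-open , U⊆ , ⊇U) (x , x∈U) =
    let x∈Lim , x∈W = U⊆ x∈U
        n , near = W-open x x∈W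
        y , (y∈EE , _) , agree = EE⁺-approximates x∈Lim n
    in y , ⊇U (proj₁ y∈EE , near y agree) , y∈EE

  EE⁺-dense : DenseIn EE EE⁺
  EE⁺-dense U (W , W-open , U⊆ , ⊇U) (x , x∈U) =
    let x∈EE , x∈W = U⊆ x∈U
        n , near = W-open x x∈W
        y , y∈EE⁺ , agree = EE⁺-approximates (proj₁ x∈EE) n
    in y , ⊇U (proj₁ y∈EE⁺ , near y agree) , y∈EE⁺

  EE⁺-open : OpenIn EE EE⁺
  EE⁺-open = (λ x → ∃[ n ] NonLi (x n)) ,
    (λ x (n , q) → suc n , λ y agree → n , q ∘′ Li-resp (agree n ℕ.≤-refl)) ,
    id , id

  -- `α i` bounds all of crit[X_i], so the countably many open conditions at the `α i` suffice.
  EE-Gδ : GδIn Lim EE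
  EE-Gδ = (λ i x → x ∈ Lim × x ∈ W i) , (λ i → W i , W-open i , id , id) ,
    (λ x∈EE i → proj₁ x∈EE , EE⇒EE′ x∈EE (suc i , α i)) ,
    (λ f → EE′⇒EE (proj₁ (f 0)) λ p@(n , a) →
      let _ , N , n<N , q = f n
      in N , ℕ.<⇒≤ n<N , NonLi-≲
           (at-mono p (suc n , α n) (ℕ.n≤1+n n) ℕ.≤-refl n<N
             (≲-trans (≡⇒≲ (≡.trans (at-suc a ℕ.≤-refl) (≡.cong (up n) (at-self a))))
               (≲-trans (up≲α a) (≡⇒≲ (≡.sym (at-self (α n))))))) q)
    where
    W : ℕ → Subset
    W i x = ∃[ N ] suc i ≤ N × NonLi (x N * at N (suc i , α i))
    W-open : ∀ i → Open (W i)
    W-open i x (N , i<N , q) = suc N , λ y agree →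
      N , i<N , q ∘′ Li-resp (L.*-cong (agree N ℕ.≤-refl) L.refl)

  -- Acyclicity and freeness

  EE⁺-LD : LDSystem _ _
  EE⁺-LD = subLDSystem ∏X EE⁺ *-closed-EE⁺

  -- Each of the finitely many partial products leaves `Li` at some level and never returns.
  foldl-path : ∀ (x : Σ Seq EE⁺) xs → ∃[ M ] ∀ N → M ≤ N →
               P.Path NonLi (proj₁ x N) (proj₁ (foldl (LDSystem._*_ EE⁺-LD) x xs) N)
  foldl-path (x , (x∈Lim , _) , n , q) [] = n , λ N n≤N →
    P.last (Lim-NonLi x∈Lim n≤N q) L.refl
  foldl-path x′@(x , (x∈Lim , _) , n , q) (y ∷ ys) =
    let M , f = foldl-path (LDSystem._*_ EE⁺-LD x′ y) ys
    in n + M , λ N n+M≤N →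
      P.step (proj₁ y N) (Lim-NonLi x∈Lim (ℕ.m+n≤o⇒m≤o n n+M≤N) q) (f N (ℕ.m+n≤o⇒n≤o n n+M≤N))

  EE⁺-acyclic : Acyclic EE⁺-LD
  EE⁺-acyclic x y ys e =
    let M , f = foldl-path (LDSystem._*_ EE⁺-LD x y) ys
    in P.no-cycle (proj₁ y M) (P.Path-respʳ (e M) (f M ℕ.≤-refl))

  -- Closure under composition.

  module Composed (comp : ∀ n → Op₂ (X.Carrier n)) (1# : ∀ n → X.Carrier n)
                  (isReduced : ∀ n → Permutativity.IsReduced (X n) (1# n))
                  (isComposition : ∀ n → Permutativity.IsComposition (X n) (comp n) (1# n)) where

    open module C {n} = CompositionTheory (X n) (comp n) (1# n) (isComposition n)
    open module IC n = Permutativity.IsComposition (isComposition n) using (∘-cong)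

    infixl 7 _∘_
    _∘_ : ∀ {n} → Op₂ (X.Carrier n)
    _∘_ {n} = comp n

    t : ∀ {n} → X.Carrier n → X.Carrier n → ℕ → X.Carrier n
    t {n} = Permutativity.t (X n)

    ∈Li⇒≈1 : ∀ {n} {x : X.Carrier n} → x ∈ Li (X n) → x ≈ 1# n
    ∈Li⇒≈1 {n} {x} = to (isReduced n x)

    1∈Li : ∀ {n} → 1# n ∈ Li (X n)
    1∈Li {n} = from (isReduced n (1# n)) L.refl

    φ-t : ∀ {n} (x y : X.Carrier (suc n)) k → φ n (t x y k) ≈ t (φ n x) (φ n y) k
    φ-t x y zero          = L.refl
    φ-t x y (suc zero)    = L.refl
    φ-t x y (suc (suc k)) = L.trans (φ.homo _ _) (L.*-cong (φ-t x y (suc k)) (φ-t x y k))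

    -- Both sides are the same term of the sequence `t`: an index that reaches `Li` upstairs does so
    -- downstairs.
    φ-∘ : ∀ {n} (x y : X.Carrier (suc n)) → φ n (x ∘ y) ≈ φ n x ∘ φ n y
    φ-∘ x y =
      let k , p = P.t-reaches-Li x y
      in L.trans (φ.⟦⟧-cong (∘≈t x y k (∈Li⇒≈1 p)))
           (L.trans (φ-t x y (suc k))
             (L.sym (∘≈t _ _ k (∈Li⇒≈1 (Li-resp (φ-t x y k) (φ-Li p))))))

    ∘-*-action : ∀ {n} (x y z : X.Carrier n) → (x ∘ y) * z ≈ x * (y * z)
    ∘-*-action x y z =
      let k , p = P.t-reaches-Li x y
      in L.trans (L.*-cong (∘≈t x y k (∈Li⇒≈1 p)) (L.sym (p z))) (L.sym (t-action x y k z))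

    -- Otherwise `y = (x ∘ y) * y = x * (y * y)`, so `y * y ≲ y`, although squaring raises crit(y).
    ∘∈Li⇒∈Li : ∀ {n} {x y : X.Carrier n} → x ∘ y ∈ Li (X n) → ¬ NonLi y
    ∘∈Li⇒∈Li {x = x} {y} p y∉Li = P.≲⇒*≴ ≲-refl y∉Li
      (≲-trans (P.≲* x (y * y)) (≈⇒≲ (L.trans (L.sym (∘-*-action x y y)) (p y))))

    ∘-closed-EE : ClosedUnder (pointwise comp) EE
    ∘-closed-EE {x} {y} x∈EE@(lift x∈Lim , _) y∈EE@(lift y∈Lim , _) = EE′⇒EE
      (lift λ n → L.trans (φ-∘ _ _) (∘-cong n (x∈Lim n) (y∈Lim n)))
      λ p → let N , n≤N , q = EE-twice x∈EE y∈EE p in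
        N , n≤N , q ∘′ Li-resp (∘-*-action _ _ _)

    ∘-closed-EE⁺ : ClosedUnder (pointwise comp) EE⁺
    ∘-closed-EE⁺ (x∈EE , _) (y∈EE , n , q) =
      ∘-closed-EE x∈EE y∈EE , n , λ p → ∘∈Li⇒∈Li p q

    -- Since `1#` acts trivially, it is enough that the maximum of each level drops below the
    -- maximum later on.
    1∈EE : 1# ∈ EE
    1∈EE = EE′⇒EE (lift λ n → ∈Li⇒≈1 (φ-Li 1∈Li)) λ (n , a) →
      let k , x′ , _ , q = extend n (⊤ n)
      in suc k + n , ℕ.m≤n+m n (suc k) , NonLi-≲ (at≲⊤ a (ℕ.m≤n+m n (suc k)))
           (P.*-∉Li⇒∉Li q ∘′ Li-resp (1∈Li _))

  -- Freeness of the generated sub-LD-monoids.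

  module Monoids (comp : ∀ n → Op₂ (X.Carrier n)) (1# : ∀ n → X.Carrier n)
                 (isPLDM : ∀ n → Permutativity.IsPermutativeLDMonoid (X n) (comp n) (1# n)) where

    private module M n = Permutativity.IsPermutativeLDMonoid (isPLDM n)

    isComposition : ∀ n → Permutativity.IsComposition (X n) (comp n) (1# n)
    isComposition n = record { ∘-cong = ∘-cong ; ∘-twist = ∘-twist ; ∘-identityʳ = identityʳ }
      where
      open IsLDMonoid (M.isLDMonoid n)

    open Composed comp 1# M.isReduced isComposition

    EE-isSubLDMonoid : IsSubLDMonoid (∏M comp 1# isPLDM) EE
    EE-isSubLDMonoid = record
      { *-closed = *-closed-EE ; ∘-closed = ∘-closed-EE ; 1-closed = 1∈EE }

    EE-LDMonoid : LDMonoid _ _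
    EE-LDMonoid = subLDMonoid (∏M comp 1# isPLDM) EE EE-isSubLDMonoid

    ≉1⇒∈EE⁺ : ∀ {x} → x ∈ EE → ¬ LDSystem._≈_ ∏X x 1# → x ∈ EE⁺
    ≉1⇒∈EE⁺ {x} x∈EE x≉1 = x∈EE , decidable-stable em
      λ none → x≉1 λ n → ∈Li⇒≈1 (decidable-stable em λ q → none (n , q))

    eval-embed : (x⁺@(x , x∈EE , _) : Σ Seq EE⁺) → ∀ s →
      proj₁ (FreeLDMonoid.eval EE-LDMonoid (x , x∈EE) (MonoidTerms.embed s)) ≡
      proj₁ (FreeLD.eval EE⁺-LD x⁺ s)
    eval-embed x FreeLD.gen       = ≡.refl
    eval-embed x (s FreeLD.* s′) = ≡.cong₂ (pointwise X._*_) (eval-embed x s) (eval-embed x s′)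

    ≉1⇒free : ∀ x → ¬ LDSystem._≈_ ∏X (proj₁ x) 1# → FreeLDMonoid.FreelyGenerates EE-LDMonoid x
    ≉1⇒free (x , x∈EE) x≉1 = MonoidTerms.free-if-free-on-LD-terms EE-LDMonoid (x , x∈EE)
      λ s t e → acyclic⇒free EE⁺-LD EE⁺-acyclic x⁺
        (≡.subst₂ (LDSystem._≈_ ∏X) (eval-embed x⁺ s) (eval-embed x⁺ t) e)
      where
      x⁺ = x , ≉1⇒∈EE⁺ x∈EE x≉1

proposition7p9 :
    ∀ {c ℓ} → ExcludedMiddle (c ⊔ ℓ) →
    (𝒳 : InverseSystem c ℓ) (vast : IsVast 𝒳) →
    let open Limit 𝒳 vast in
    -- (1)
    (DenseIn Lim EE × GδIn Lim EE × DenseIn EE EE⁺ × OpenIn EE EE⁺) ×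
    -- (2)
    ClosedUnder (pointwise X._*_) EE ×
    (Σ[ *-closed ∈ ClosedUnder (pointwise X._*_) EE⁺ ]
      ((comp : ∀ n → Op₂ (X.Carrier n)) (1# : ∀ n → X.Carrier n) →
        (∀ n → Permutativity.IsReduced (X n) (1# n)) →
        (∀ n → Permutativity.IsComposition (X n) (comp n) (1# n)) →
        ClosedUnder (pointwise comp) EE × ClosedUnder (pointwise comp) EE⁺) ×
      -- (3)
      Acyclic (subLDSystem ∏X EE⁺ *-closed) ×
      -- (4)
      (∀ x → FreeLD.FreelyGenerates (subLDSystem ∏X EE⁺ *-closed) x) ×
      ((comp : ∀ n → Op₂ (X.Carrier n)) (1# : ∀ n → X.Carrier n) →
        (isPLDM : ∀ n → Permutativity.IsPermutativeLDMonoid (X n) (comp n) (1# n)) →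
        Σ[ closed ∈ IsSubLDMonoid (∏M comp 1# isPLDM) EE ]
          (∀ x → ¬ (LDSystem._≈_ ∏X (proj₁ x) 1#) →
            FreeLDMonoid.FreelyGenerates (subLDMonoid (∏M comp 1# isPLDM) EE closed) x)))
proposition7p9 em 𝒳 vast =
  (EE-dense , EE-Gδ , EE⁺-dense , EE⁺-open) ,
  *-closed-EE ,
  *-closed-EE⁺ ,
  (λ comp 1# isReduced isComposition →
    Composed.∘-closed-EE comp 1# isReduced isComposition ,
    Composed.∘-closed-EE⁺ comp 1# isReduced isComposition) ,
  EE⁺-acyclic ,
  acyclic⇒free EE⁺-LD EE⁺-acyclic ,
  (λ comp 1# isPLDM →
    Monoids.EE-isSubLDMonoid comp 1# isPLDM , Monoids.≉1⇒free comp 1# isPLDM)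
  where
  open VastTheory em 𝒳 vast
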